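{- For every finite simple graph $G=(V,E)$, the quantity $B_f(G)$ is a $4$-approximation of the bandwidth $B(G)$, in the sense that $$\frac{B(G)}{2}\;\le\; B_f(G)\;\le\; 2B(G).$$
   Context: A graph $G'=(V,E')$ with $V=\{v_1,\dots,v_n\}$ is a function graph if there exist continuous functions $f_1,\dots,f_n:[0,1]\to\mathbb{R}$ such that, for $i\ne j$, $v_iv_j\in E'$ if and only if $f_i(t)=f_j(t)$ for some $t\in[0,1]$. $B_f(G)$ is the minimum, over all function graphs $G'=(V,E')$ with $E\subseteq E'$, of the maximum degree of $G'$. The bandwidth of $G$ is $B(G):=\min_{\sigma}\max_{uv\in E}|\sigma(u)-\sigma(v)|$, where $\sigma$ ranges over all bijections $V\to\{1,\dots,|V|\}$ (and the maximum over an empty edge set is $0$). -}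

module Defs where

open import Data.Bool using (Bool; T; T?)
open import Data.Fin using (Fin; toℕ)
open import Data.Fin.Permutation using (Permutation′; _⟨$⟩ʳ_)
open import Data.List using (List; allFin; cartesianProduct; filter; length; map)
open import Data.List.Extrema.Nat using (max)
open import Data.Nat as ℕ using (ℕ)
import Data.Nat.Properties as ℕₚ
open import Data.Product using (Σ-syntax; ∃-syntax; _×_; _,_; proj₁; uncurry)
open import Data.Rational as ℚ using (ℚ; 0ℚ; 1ℚ; ½)
import Data.Rational.Properties as ℚₚ
open import Data.Rational.Solver using (module +-*-Solver)
open import Data.Sum using (inj₁; inj₂)
open import Function using (_⇔_)
open import Relation.Binary.PropositionalEquality
  using (_≡_; _≢_; refl; sym; trans; cong; subst)
open import Relation.Nullary using (¬_)

------------------------------------------------------------------------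
-- The real numbers, as the Cauchy completion of ℚ: Cauchy sequences of
-- rationals, identified when their difference tends to 0.

IsCauchy : (ℕ → ℚ) → Set
IsCauchy x = ∀ ε → 0ℚ ℚ.< ε →
  ∃[ N ] (∀ m n → N ℕ.≤ m → N ℕ.≤ n → ℚ.∣ x m ℚ.- x n ∣ ℚ.< ε)

record ℝ : Set where
  constructor mkℝ
  field
    seq    : ℕ → ℚ
    cauchy : IsCauchy seq

open ℝ public

infix 4 _≈_ _<_ _≤_

_≈_ : ℝ → ℝ → Set
x ≈ y = ∀ ε → 0ℚ ℚ.< ε →
  ∃[ N ] (∀ n → N ℕ.≤ n → ℚ.∣ seq x n ℚ.- seq y n ∣ ℚ.< ε)

-- A termwise comparison would not respect _≈_; the sequences have to
-- stay apart by a fixed positive amount from some index on.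
_<_ : ℝ → ℝ → Set
x < y = ∃[ ε ] (0ℚ ℚ.< ε ×
  ∃[ N ] (∀ n → N ℕ.≤ n → seq x n ℚ.+ ε ℚ.< seq y n))

_≤_ : ℝ → ℝ → Set
x ≤ y = ¬ (y < x)

fromℚ : ℚ → ℝ
fromℚ q = mkℝ (λ _ → q) λ ε 0<ε →
  0 , λ _ _ _ _ → subst (ℚ._< ε) (sym (cong ℚ.∣_∣ (ℚₚ.+-inverseʳ q))) 0<ε

0ℝ 1ℝ : ℝ
0ℝ = fromℚ 0ℚ
1ℝ = fromℚ 1ℚ

infixl 6 _-_

_-_ : ℝ → ℝ → ℝ
x - y = mkℝ (λ n → seq x n ℚ.- seq y n) isCauchy
  where
  regroup : ∀ a b c d →
    (a ℚ.- b) ℚ.- (c ℚ.- d) ≡ (a ℚ.- c) ℚ.- (b ℚ.- d)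
  regroup = solve 4
    (λ a b c d → (a :- b) :- (c :- d) := (a :- c) :- (b :- d)) refl
    where open +-*-Solver

  halves : ∀ ε → ½ ℚ.* ε ℚ.+ ½ ℚ.* ε ≡ ε
  halves ε = trans (sym (ℚₚ.*-distribʳ-+ ε ½ ½)) (ℚₚ.*-identityˡ ε)

  isCauchy : IsCauchy (λ n → seq x n ℚ.- seq y n)
  isCauchy ε 0<ε
    with cauchy x (½ ℚ.* ε) 0<ε/2 | cauchy y (½ ℚ.* ε) 0<ε/2
    where
    0<ε/2 : 0ℚ ℚ.< ½ ℚ.* ε
    0<ε/2 = ℚₚ.*-monoʳ-<-pos ½ 0<ε
  ... | N₁ , near₁ | N₂ , near₂ = N₁ ℕ.⊔ N₂ , λ m n N≤m N≤n →
    let open ℚₚ.≤-Reasoning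
        a = seq x m ; b = seq y m ; c = seq x n ; d = seq y n
    in begin-strict
      ℚ.∣ (a ℚ.- b) ℚ.- (c ℚ.- d) ∣        ≡⟨ cong ℚ.∣_∣ (regroup a b c d) ⟩
      ℚ.∣ (a ℚ.- c) ℚ.- (b ℚ.- d) ∣        ≤⟨ ℚₚ.∣p-q∣≤∣p∣+∣q∣ (a ℚ.- c) (b ℚ.- d) ⟩
      ℚ.∣ a ℚ.- c ∣ ℚ.+ ℚ.∣ b ℚ.- d ∣      <⟨ ℚₚ.+-mono-<
        (near₁ m n (ℕₚ.m⊔n≤o⇒m≤o N₁ N₂ N≤m) (ℕₚ.m⊔n≤o⇒m≤o N₁ N₂ N≤n))
        (near₂ m n (ℕₚ.m⊔n≤o⇒n≤o N₁ N₂ N≤m) (ℕₚ.m⊔n≤o⇒n≤o N₁ N₂ N≤n)) ⟩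
      ½ ℚ.* ε ℚ.+ ½ ℚ.* ε                  ≡⟨ halves ε ⟩
      ε                                    ∎

∣p∣-∣q∣≤∣p-q∣ : ∀ p q → ℚ.∣ p ∣ ℚ.- ℚ.∣ q ∣ ℚ.≤ ℚ.∣ p ℚ.- q ∣
∣p∣-∣q∣≤∣p-q∣ p q = begin
  ℚ.∣ p ∣ ℚ.- ℚ.∣ q ∣                            ≡⟨ cong (λ r → ℚ.∣ r ∣ ℚ.- ℚ.∣ q ∣) (split p q) ⟩
  ℚ.∣ (p ℚ.- q) ℚ.+ q ∣ ℚ.- ℚ.∣ q ∣              ≤⟨ ℚₚ.+-monoˡ-≤ (ℚ.- ℚ.∣ q ∣) (ℚₚ.∣p+q∣≤∣p∣+∣q∣ (p ℚ.- q) q) ⟩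
  (ℚ.∣ p ℚ.- q ∣ ℚ.+ ℚ.∣ q ∣) ℚ.- ℚ.∣ q ∣        ≡⟨ cancel ℚ.∣ p ℚ.- q ∣ ℚ.∣ q ∣ ⟩
  ℚ.∣ p ℚ.- q ∣                                  ∎
  where
  open ℚₚ.≤-Reasoning
  open +-*-Solver
  split : ∀ a b → a ≡ (a ℚ.- b) ℚ.+ b
  split = solve 2 (λ a b → a := (a :- b) :+ b) refl
  cancel : ∀ a b → (a ℚ.+ b) ℚ.- b ≡ a
  cancel = solve 2 (λ a b → (a :+ b) :- b := a) refl

∣∣p∣-∣q∣∣≤∣p-q∣ : ∀ p q → ℚ.∣ ℚ.∣ p ∣ ℚ.- ℚ.∣ q ∣ ∣ ℚ.≤ ℚ.∣ p ℚ.- q ∣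
∣∣p∣-∣q∣∣≤∣p-q∣ p q with ℚₚ.∣p∣≡p∨∣p∣≡-p (ℚ.∣ p ∣ ℚ.- ℚ.∣ q ∣)
... | inj₁ eq = subst (ℚ._≤ ℚ.∣ p ℚ.- q ∣) (sym eq) (∣p∣-∣q∣≤∣p-q∣ p q)
... | inj₂ eq = begin
  ℚ.∣ ℚ.∣ p ∣ ℚ.- ℚ.∣ q ∣ ∣     ≡⟨ eq ⟩
  ℚ.- (ℚ.∣ p ∣ ℚ.- ℚ.∣ q ∣)     ≡⟨ swap ℚ.∣ p ∣ ℚ.∣ q ∣ ⟩
  ℚ.∣ q ∣ ℚ.- ℚ.∣ p ∣           ≤⟨ ∣p∣-∣q∣≤∣p-q∣ q p ⟩
  ℚ.∣ q ℚ.- p ∣                 ≡⟨ cong ℚ.∣_∣ (swap p q) ⟨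
  ℚ.∣ ℚ.- (p ℚ.- q) ∣           ≡⟨ ℚₚ.∣-p∣≡∣p∣ (p ℚ.- q) ⟩
  ℚ.∣ p ℚ.- q ∣                 ∎
  where
  open ℚₚ.≤-Reasoning
  open +-*-Solver
  swap : ∀ a b → ℚ.- (a ℚ.- b) ≡ b ℚ.- a
  swap = solve 2 (λ a b → :- (a :- b) := b :- a) refl

∣_∣ : ℝ → ℝ
∣ x ∣ = mkℝ (λ n → ℚ.∣ seq x n ∣) λ ε 0<ε →
  let N , near = cauchy x ε 0<ε in
  N , λ m n N≤m N≤n →
    ℚₚ.≤-<-trans (∣∣p∣-∣q∣∣≤∣p-q∣ (seq x m) (seq x n)) (near m n N≤m N≤n)

------------------------------------------------------------------------
-- Continuous functions [0,1] → ℝ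

I : Set
I = Σ[ t ∈ ℝ ] (0ℝ ≤ t × t ≤ 1ℝ)

-- Any function continuous in this sense sends ≈-equal points to ≈-equal
-- values and ignores the proofs of membership in [0,1].
Continuous : (I → ℝ) → Set
Continuous f = ∀ s ε → 0ℝ < ε →
  ∃[ δ ] (0ℝ < δ ×
    (∀ t → ∣ proj₁ t - proj₁ s ∣ < δ → ∣ f t - f s ∣ < ε))

------------------------------------------------------------------------
-- Finite simple graphs

-- The vertex set is Fin n.  Adjacency is Boolean, so that degrees are
-- computed by counting.
record Graph (n : ℕ) : Set where
  field
    adj    : Fin n → Fin n → Bool
    symm   : ∀ u v → T (adj u v) → T (adj v u)
    irrefl : ∀ v → ¬ T (adj v v)

open Graph public

_⊆_ : ∀ {n} → Graph n → Graph n → Set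
G ⊆ H = ∀ u v → T (adj G u v) → T (adj H u v)

degree : ∀ {n} → Graph n → Fin n → ℕ
degree {n} G v = length (filter (λ u → T? (adj G v u)) (allFin n))

maxDegree : ∀ {n} → Graph n → ℕ
maxDegree {n} G = max 0 (map (degree G) (allFin n))

IsFunctionGraph : ∀ {n} → Graph n → Set
IsFunctionGraph {n} G =
  Σ[ f ∈ (Fin n → I → ℝ) ]
    ((∀ i → Continuous (f i)) ×
     (∀ i j → i ≢ j → T (adj G i j) ⇔ (∃[ t ] f i t ≈ f j t)))

------------------------------------------------------------------------
-- Bandwidth and B_f

IsMinimumOf : {A : Set} → (A → ℕ) → ℕ → Set
IsMinimumOf f m = (∃[ a ] f a ≡ m) × (∀ a → m ℕ.≤ f a)

edges : ∀ {n} → Graph n → List (Fin n × Fin n)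
edges {n} G =
  filter (λ e → T? (uncurry (adj G) e)) (cartesianProduct (allFin n) (allFin n))

-- Labels are 0,…,n-1 instead of 1,…,n, which leaves all differences
-- unchanged.
width : ∀ {n} → Graph n → Permutation′ n → ℕ
width G σ =
  max 0 (map (λ (u , v) → ℕ.∣ toℕ (σ ⟨$⟩ʳ u) - toℕ (σ ⟨$⟩ʳ v) ∣) (edges G))

IsBandwidth : ∀ {n} → Graph n → ℕ → Set
IsBandwidth G = IsMinimumOf (width G)

FunctionSupergraph : ∀ {n} → Graph n → Set
FunctionSupergraph {n} G = Σ[ G′ ∈ Graph n ] (IsFunctionGraph G′ × G ⊆ G′)

-- IsB_f G b says that B_f(G) = b.
IsB_f : ∀ {n} → Graph n → ℕ → Set
IsB_f G = IsMinimumOf {A = FunctionSupergraph G} (λ (G′ , _) → maxDegree G′)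

{-# OPTIONS --safe #-}
-- The functions of a function graph are ordered by "lies below everywhere",
-- and by the intermediate value theorem two vertices are incomparable exactly
-- when they are adjacent.  Number the vertices along a linear extension of
-- this order.  A vertex strictly between the ends of an edge uv is adjacent
-- to u or to v, since otherwise u and v would be comparable; so the labels of
-- u and v differ by at most deg u + deg v.
--
-- Conversely, given a labelling of width k, join all vertices whose labels
-- differ by at most k.  Degrees are then at most 2k, and the graph is a function
-- graph: let vertex i rise linearly from height i to i + k, one vertex after
-- the other, in the order of the labels.
module Submission where

open import Defs
open import Axiom.ExcludedMiddle using (ExcludedMiddle)
open import Data.Bool using (T; T?)
open import Data.Fin as Fin using (Fin; toℕ; fromℕ<; combine)
open import Data.Fin.Permutation as Permutation using (Permutation′; permutation; _⟨$⟩ʳ_)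
import Data.Fin.Properties as Finₚ
open import Data.Integer as ℤ using (+_; -[1+_])
import Data.Integer.Properties as ℤₚ
open import Data.List using (List; []; _∷_; allFin; cartesianProduct; filter; length)
open import Data.List.Extrema.Nat using (max≤v⁺; v≤max⁺)
open import Data.List.Membership.Propositional using (_∈_; lose)
open import Data.List.Membership.Propositional.Properties
  using (∈-allFin; ∈-filter⁺; ∈-filter⁻; ∈-map⁺; ∈-cartesianProduct⁺)
open import Data.List.Properties using (filter-notAll; filter-none; length-tabulate)
open import Data.List.Relation.Unary.All as All using (All)
import Data.List.Relation.Unary.All.Properties as Allₚ
open import Data.List.Relation.Unary.AllPairs using (_∷_)
open import Data.List.Relation.Unary.Any using (here; there)
open import Data.List.Relation.Unary.Unique.Propositional using (Unique)
import Data.List.Relation.Unary.Unique.Propositional.Properties as Uniqueₚ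
open import Data.Nat as ℕ using (ℕ; zero; suc; z≤n; s≤s)
import Data.Nat.Coprimality as Coprimality
import Data.Nat.Properties as ℕₚ
open import Data.Product using (∃-syntax; _×_; _,_; proj₁; proj₂; uncurry)
open import Data.Rational as ℚ using (ℚ; mkℚ; 0ℚ; 1ℚ; ½; _/_)
import Data.Rational.Properties as ℚₚ
import Data.Rational.Unnormalised as ℚᵘ
import Data.Rational.Unnormalised.Properties as ℚᵘₚ
open import Data.Sum using (_⊎_; inj₁; inj₂; [_,_]′)
open import Function using (_∘_; case_of_; mk⇔; module Equivalence)
open import Function.Bundles using (module Injection)
open import Function.Definitions using (Injective)
open import Function.Properties.Inverse using (↔⇒↣)
open import Level using (0ℓ)
open import Relation.Binary using (Rel; Transitive; Decidable; tri<; tri≈; tri>)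
open import Relation.Binary.PropositionalEquality
  using (_≡_; _≢_; refl; sym; trans; cong; cong₂; subst; module ≡-Reasoning)
open import Relation.Nullary
  using (¬_; Dec; yes; no; contradiction; ¬?; _×-dec_; _⊎-dec_)
open import Relation.Nullary.Decidable
  using (⌊_⌋; toWitness; fromWitness; decidable-stable; dec⇒maybe)
import Relation.Unary as Unary
open import Tactic.RingSolver using (solve; solve-∀)
open import Tactic.RingSolver.Core.AlmostCommutativeRing
  using (AlmostCommutativeRing; fromCommutativeRing)

-- Rational arithmetic

ℚ-ring : AlmostCommutativeRing 0ℓ 0ℓ
ℚ-ring = fromCommutativeRing ℚₚ.+-*-commutativeRing λ p → dec⇒maybe (0ℚ ℚₚ.≟ p)

module _ {a b p q : ℚ} where
  private
    left : a ℚ.+ (p ℚ.- a) ≡ p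
    left = solve (a ∷ p ∷ []) ℚ-ring

    right : b ℚ.- a ≡ q ℚ.- p → b ℚ.+ (p ℚ.- a) ≡ q
    right eq = trans (shuffle a b p) (trans (cong (ℚ._+ p) eq) (cancel p q))
      where
      shuffle : ∀ a b p → b ℚ.+ (p ℚ.- a) ≡ (b ℚ.- a) ℚ.+ p
      shuffle = solve-∀ ℚ-ring
      cancel : ∀ p q → (q ℚ.- p) ℚ.+ p ≡ q
      cancel = solve-∀ ℚ-ring

  -- Linear arithmetic: add up the hypotheses into a < b, and leave it to
  -- the ring solver that the two differences agree.
  shift-< : a ℚ.< b → b ℚ.- a ≡ q ℚ.- p → p ℚ.< q
  shift-< a<b eq = let open ℚₚ.≤-Reasoning in begin-strict
    p                  ≡⟨ left ⟨
    a ℚ.+ (p ℚ.- a)    <⟨ ℚₚ.+-monoˡ-< (p ℚ.- a) a<b ⟩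
    b ℚ.+ (p ℚ.- a)    ≡⟨ right eq ⟩
    q                  ∎

  shift-≤ : a ℚ.≤ b → b ℚ.- a ≡ q ℚ.- p → p ℚ.≤ q
  shift-≤ a≤b eq = let open ℚₚ.≤-Reasoning in begin
    p                  ≡⟨ left ⟨
    a ℚ.+ (p ℚ.- a)    ≤⟨ ℚₚ.+-monoˡ-≤ (p ℚ.- a) a≤b ⟩
    b ℚ.+ (p ℚ.- a)    ≡⟨ right eq ⟩
    q                  ∎

p≤p+ε : ∀ p {ε} → 0ℚ ℚ.≤ ε → p ℚ.≤ p ℚ.+ ε
p≤p+ε p {ε} 0≤ε = shift-≤ 0≤ε (solve (p ∷ ε ∷ []) ℚ-ring)

halve : ∀ ε → 0ℚ ℚ.< ε → ∃[ η ] (0ℚ ℚ.< η × η ℚ.+ η ≡ ε)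
halve ε 0<ε = ½ ℚ.* ε , ℚₚ.*-monoʳ-<-pos ½ 0<ε ,
  trans (sym (ℚₚ.*-distribʳ-+ ε ½ ½)) (ℚₚ.*-identityˡ ε)

p≤∣p∣ : ∀ p → p ℚ.≤ ℚ.∣ p ∣
p≤∣p∣ p with ℚₚ.≤-total 0ℚ p
... | inj₁ 0≤p = ℚₚ.≤-reflexive (sym (ℚₚ.0≤p⇒∣p∣≡p 0≤p))
... | inj₂ p≤0 = ℚₚ.≤-trans p≤0 (ℚₚ.0≤∣p∣ p)

∣p-q∣≡∣q-p∣ : ∀ p q → ℚ.∣ p ℚ.- q ∣ ≡ ℚ.∣ q ℚ.- p ∣
∣p-q∣≡∣q-p∣ p q =
  trans (sym (ℚₚ.∣-p∣≡∣p∣ (p ℚ.- q))) (cong ℚ.∣_∣ (swap p q))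
  where
  swap : ∀ p q → ℚ.- (p ℚ.- q) ≡ q ℚ.- p
  swap = solve-∀ ℚ-ring

p≤q+∣p-q∣ : ∀ p q → p ℚ.≤ q ℚ.+ ℚ.∣ p ℚ.- q ∣
p≤q+∣p-q∣ p q = shift-≤ (p≤∣p∣ (p ℚ.- q)) (regroup p q ℚ.∣ p ℚ.- q ∣)
  where
  regroup : ∀ p q r → r ℚ.- (p ℚ.- q) ≡ (q ℚ.+ r) ℚ.- p
  regroup = solve-∀ ℚ-ring

near-upper : ∀ p q {ε} → ℚ.∣ p ℚ.- q ∣ ℚ.< ε → p ℚ.< q ℚ.+ ε
near-upper p q near =
  ℚₚ.≤-<-trans (p≤q+∣p-q∣ p q) (ℚₚ.+-monoʳ-< q near)

near-lower : ∀ p q {ε} → ℚ.∣ p ℚ.- q ∣ ℚ.< ε → q ℚ.< p ℚ.+ ε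
near-lower p q {ε} near =
  near-upper q p (subst (ℚ._< ε) (∣p-q∣≡∣q-p∣ p q) near)

∣p-q∣≤ε : ∀ p q {ε} → p ℚ.≤ q ℚ.+ ε → q ℚ.≤ p ℚ.+ ε → ℚ.∣ p ℚ.- q ∣ ℚ.≤ ε
∣p-q∣≤ε p q {ε} p≤q+ε q≤p+ε with ℚₚ.∣p∣≡p∨∣p∣≡-p (p ℚ.- q)
... | inj₁ eq = subst (ℚ._≤ ε) (sym eq)
  (shift-≤ p≤q+ε (solve (p ∷ q ∷ ε ∷ []) ℚ-ring))
... | inj₂ eq = subst (ℚ._≤ ε) (sym eq)
  (shift-≤ q≤p+ε (solve (p ∷ q ∷ ε ∷ []) ℚ-ring))

fromℕ : ℕ → ℚ
fromℕ n = mkℚ (+ n) 0 (Coprimality.sym (Coprimality.1-coprimeTo n))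

fromℕ-mono-≤ : ∀ {m n} → m ℕ.≤ n → fromℕ m ℚ.≤ fromℕ n
fromℕ-mono-≤ m≤n = ℚ.*≤* (ℤₚ.*-monoʳ-≤-nonNeg (+ 1) (ℤ.+≤+ m≤n))

fromℕ-+ : ∀ m n → fromℕ (m ℕ.+ n) ≡ fromℕ m ℚ.+ fromℕ n
fromℕ-+ m n = ℚₚ.toℚᵘ-injective (ℚᵘₚ.≃-trans
  (ℚᵘ.*≡* (cong (ℤ._* + 1) (sym (cong₂ ℤ._+_ (ℤₚ.*-identityʳ (+ m)) (ℤₚ.*-identityʳ (+ n))))))
  (ℚᵘₚ.≃-sym (ℚₚ.toℚᵘ-homo-+ (fromℕ m) (fromℕ n))))

-- A nonnegative fraction is at most its numerator, because the denominator is at least 1; the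
-- successor of the numerator is therefore strictly larger.
archimedean : ∀ q → ∃[ N ] q ℚ.< fromℕ N
archimedean (mkℚ (+ n) d-1 _) = suc n , ℚ.*<* (ℤₚ.<-≤-trans
  (ℤₚ.*-monoʳ-<-pos (+ 1) (ℤ.+<+ (ℕₚ.n<1+n n)))
  (ℤₚ.*-monoˡ-≤-nonNeg (+ suc n) (ℤ.+≤+ (s≤s z≤n))))
archimedean (mkℚ -[1+ n ] d-1 _) = 0 , ℚ.*<* ℤ.-<+

-- Clamping to [0,c]

clamp : ℚ → ℚ → ℚ
clamp c p = 0ℚ ℚ.⊔ (p ℚ.⊓ c)

0≤clamp : ∀ c p → 0ℚ ℚ.≤ clamp c p
0≤clamp c p = ℚₚ.p≤p⊔q 0ℚ (p ℚ.⊓ c)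

clamp≤ : ∀ {c} p → 0ℚ ℚ.≤ c → clamp c p ℚ.≤ c
clamp≤ {c} p 0≤c = ℚₚ.⊔-lub 0≤c (ℚₚ.p⊓q≤q p c)

clamp-id : ∀ {c p} → 0ℚ ℚ.≤ p → p ℚ.≤ c → clamp c p ≡ p
clamp-id 0≤p p≤c =
  trans (cong (0ℚ ℚ.⊔_) (ℚₚ.p≤q⇒p⊓q≡p p≤c)) (ℚₚ.p≤q⇒p⊔q≡q 0≤p)

clamp-zero : ∀ {c p} → p ℚ.≤ 0ℚ → clamp c p ≡ 0ℚ
clamp-zero {c} {p} p≤0 = ℚₚ.p≥q⇒p⊔q≡p (ℚₚ.≤-trans (ℚₚ.p⊓q≤p p c) p≤0)

-- Together with `≤clamp+`, this covers rationals known to lie in `[0,c]` only up to an error `ε`: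
-- clamping moves them by at most `ε`.
clamp≤+ : ∀ c p {ε} → ℚ.- ε ℚ.≤ p → 0ℚ ℚ.≤ ε → clamp c p ℚ.≤ p ℚ.+ ε
clamp≤+ c p {ε} -ε≤p 0≤ε = ℚₚ.⊔-lub {p ℚ.+ ε} {0ℚ} {p ℚ.⊓ c}
  (shift-≤ -ε≤p (solve (p ∷ ε ∷ []) ℚ-ring))
  (ℚₚ.≤-trans (ℚₚ.p⊓q≤p p c) (p≤p+ε p 0≤ε))

≤clamp+ : ∀ c p {ε} → p ℚ.≤ c ℚ.+ ε → 0ℚ ℚ.≤ ε → p ℚ.≤ clamp c p ℚ.+ ε
≤clamp+ c p {ε} p≤c+ε 0≤ε = shift-≤
  (ℚₚ.≤-trans
    (ℚₚ.⊓-glb {p ℚ.- ε} {p} {c}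
      (shift-≤ 0≤ε (solve (p ∷ ε ∷ []) ℚ-ring))
      (shift-≤ p≤c+ε (solve (p ∷ c ∷ ε ∷ []) ℚ-ring)))
    (ℚₚ.p≤q⊔p 0ℚ (p ℚ.⊓ c)))
  (regroup (clamp c p) p ε)
  where
  regroup : ∀ r p ε → r ℚ.- (p ℚ.- ε) ≡ (r ℚ.+ ε) ℚ.- p
  regroup = solve-∀ ℚ-ring

-- One half of non-expansiveness: a nonnegative slack `ε` passes through the minimum with `c` and
-- then through the maximum with 0.
clamp-mono-+ : ∀ c p q {ε} → 0ℚ ℚ.≤ ε → p ℚ.≤ q ℚ.+ ε →
  clamp c p ℚ.≤ clamp c q ℚ.+ ε
clamp-mono-+ c p q {ε} 0≤ε p≤q+ε = ℚₚ.⊔-lub {clamp c q ℚ.+ ε} {0ℚ} {p ℚ.⊓ c}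
  (ℚₚ.+-mono-≤ (0≤clamp c q) 0≤ε)
  (ℚₚ.≤-trans p⊓c≤ (ℚₚ.+-monoˡ-≤ ε (ℚₚ.p≤q⊔p 0ℚ (q ℚ.⊓ c))))
  where
  m = p ℚ.⊓ c
  out : ∀ m q ε → q ℚ.- (m ℚ.- ε) ≡ (q ℚ.+ ε) ℚ.- m
  out = solve-∀ ℚ-ring
  into : ∀ m q ε → (q ℚ.+ ε) ℚ.- m ≡ q ℚ.- (m ℚ.- ε)
  into = solve-∀ ℚ-ring
  p⊓c≤ : p ℚ.⊓ c ℚ.≤ (q ℚ.⊓ c) ℚ.+ ε
  p⊓c≤ = shift-≤
    (ℚₚ.⊓-glb {m ℚ.- ε} {q} {c}
      (shift-≤ (ℚₚ.≤-trans (ℚₚ.p⊓q≤p p c) p≤q+ε) (into m q ε))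
      (shift-≤ (ℚₚ.≤-trans (ℚₚ.p⊓q≤q p c) (p≤p+ε c 0≤ε)) (into m c ε)))
    (out m (q ℚ.⊓ c) ε)

clamp-nonExpansive : ∀ c p q →
  ℚ.∣ clamp c p ℚ.- clamp c q ∣ ℚ.≤ ℚ.∣ p ℚ.- q ∣
clamp-nonExpansive c p q = ∣p-q∣≤ε (clamp c p) (clamp c q)
  (clamp-mono-+ c p q (ℚₚ.0≤∣p∣ _) (p≤q+∣p-q∣ p q))
  (clamp-mono-+ c q p (ℚₚ.0≤∣p∣ _)
    (subst (λ r → q ℚ.≤ p ℚ.+ r) (∣p-q∣≡∣q-p∣ q p) (p≤q+∣p-q∣ q p)))

-- Order and continuity of real functions

Eventually : (ℕ → Set) → Set
Eventually P = ∃[ N ] (∀ n → N ℕ.≤ n → P n)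

infixr 5 _∩ᵉ_
_∩ᵉ_ : ∀ {P Q} → Eventually P → Eventually Q → Eventually (λ n → P n × Q n)
(M , p) ∩ᵉ (N , q) = M ℕ.⊔ N , λ n M⊔N≤n →
  p n (ℕₚ.m⊔n≤o⇒m≤o M N M⊔N≤n) , q n (ℕₚ.m⊔n≤o⇒n≤o M N M⊔N≤n)

mapᵉ : ∀ {P Q} → (∀ {n} → P n → Q n) → Eventually P → Eventually Q
mapᵉ f (N , p) = N , λ n N≤n → f (p n N≤n)

witness : ∀ {P} → Eventually P → ∃[ n ] P n
witness (N , p) = N , p N ℕₚ.≤-refl

always : ∀ {P} → (∀ n → P n) → Eventually P
always p = 0 , λ n _ → p n

<⇒≱ : ∀ {p q ε} → 0ℚ ℚ.< ε → p ℚ.+ ε ℚ.< q → ¬ q ℚ.≤ p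
<⇒≱ {p} 0<ε p+ε<q q≤p = ℚₚ.<-irrefl refl
  (ℚₚ.<-≤-trans p+ε<q (ℚₚ.≤-trans q≤p (p≤p+ε p (ℚₚ.<⇒≤ 0<ε))))

seq-≤⇒≤ : ∀ {x y} → Eventually (λ n → seq x n ℚ.≤ seq y n) → x ≤ y
seq-≤⇒≤ x≤y (ε , 0<ε , y<x) =
  let _ , h , k = witness (x≤y ∩ᵉ y<x) in <⇒≱ 0<ε k h

private
  -- Here `a`, `b` are terms of two sequences at one index and `c`, `d` at another. Moving between
  -- the indices costs less than `η` of the gap `η + η`.
  gap : ∀ a b c d η → b ℚ.+ (η ℚ.+ η) ℚ.< a →
    ℚ.∣ (a ℚ.- b) ℚ.- (c ℚ.- d) ∣ ℚ.< η → d ℚ.+ η ℚ.< c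
  gap a b c d η b+ε<a near = shift-<
    (ℚₚ.+-mono-< b+ε<a (near-upper (a ℚ.- b) (c ℚ.- d) near)) (regroup a b c d η)
    where
    regroup : ∀ a b c d η →
      (a ℚ.+ ((c ℚ.- d) ℚ.+ η)) ℚ.- ((b ℚ.+ (η ℚ.+ η)) ℚ.+ (a ℚ.- b)) ≡
      c ℚ.- (d ℚ.+ η)
    regroup = solve-∀ ℚ-ring

-- Since `x ≤ y` is a negation, a single late violation has to refute it. As `x - y` is Cauchy, the
-- violation persists at all late indices, with half the margin, and so proves `y < x`.
≤⇒seq-≤ : ∀ {x y} → x ≤ y → ∀ ε → 0ℚ ℚ.< ε →
  Eventually (λ n → seq x n ℚ.≤ seq y n ℚ.+ ε)
≤⇒seq-≤ {x} {y} x≤y ε 0<ε = N , bound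
  where
  η = proj₁ (halve ε 0<ε)
  0<η = proj₁ (proj₂ (halve ε 0<ε))
  η+η≡ε = proj₂ (proj₂ (halve ε 0<ε))
  N = proj₁ (cauchy (x - y) η 0<η)

  near : ∀ m n → N ℕ.≤ m → N ℕ.≤ n →
    ℚ.∣ (seq x m ℚ.- seq y m) ℚ.- (seq x n ℚ.- seq y n) ∣ ℚ.< η
  near = proj₂ (cauchy (x - y) η 0<η)

  bound : ∀ n → N ℕ.≤ n → seq x n ℚ.≤ seq y n ℚ.+ ε
  bound n N≤n = ℚₚ.≮⇒≥ λ y+ε<x → x≤y (η , 0<η , N , λ m N≤m →
    gap (seq x n) (seq y n) (seq x m) (seq y m) η
      (subst (λ r → seq y n ℚ.+ r ℚ.< seq x n) (sym η+η≡ε) y+ε<x)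
      (near n m N≤n N≤m))
trichotomy : ExcludedMiddle 0ℓ → ∀ x y → x < y ⊎ y < x ⊎ x ≈ y
trichotomy em x y with em {x < y} | em {y < x}
... | yes x<y | _       = inj₁ x<y
... | no _    | yes y<x = inj₂ (inj₁ y<x)
... | no x≮y  | no y≮x  = inj₂ (inj₂ x≈y)
  where
  x≈y : x ≈ y
  x≈y ε 0<ε with halve ε 0<ε
  ... | η , 0<η , refl = mapᵉ
    (λ {n} (x≤y , y≤x) → ℚₚ.≤-<-trans (∣p-q∣≤ε (seq x n) (seq y n) x≤y y≤x)
      (subst (ℚ._< η ℚ.+ η) (ℚₚ.+-identityʳ η) (ℚₚ.+-monoʳ-< η 0<η)))
    (≤⇒seq-≤ {x} {y} y≮x η 0<η ∩ᵉ ≤⇒seq-≤ {y} {x} x≮y η 0<η)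

<⇒≉ : ∀ {x y} → x < y → ¬ x ≈ y
<⇒≉ {x} {y} (ε , 0<ε , x<y) x≈y =
  let n , gap , near = witness (x<y ∩ᵉ x≈y ε 0<ε)
  in ℚₚ.<-asym gap (near-lower (seq x n) (seq y n) near)

≈-sym : ∀ {x y} → x ≈ y → y ≈ x
≈-sym {x} {y} x≈y ε 0<ε =
  mapᵉ (λ {n} → subst (ℚ._< ε) (∣p-q∣≡∣q-p∣ (seq x n) (seq y n))) (x≈y ε 0<ε)

<-trans : ∀ {x y z} → x < y → y < z → x < z
<-trans {y = y} (ε , 0<ε , x<y) (η , 0<η , y<z) = ε , 0<ε , mapᵉ
  (λ {n} (h , k) → ℚₚ.<-trans h
    (ℚₚ.≤-<-trans (p≤p+ε (seq y n) (ℚₚ.<⇒≤ 0<η)) k))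
  (x<y ∩ᵉ y<z)

<-asym : ∀ {x y} → x < y → ¬ y < x
<-asym (ε , 0<ε , x<y) (η , 0<η , y<x) =
  let _ , h , k = witness (x<y ∩ᵉ y<x)
  in <⇒≱ 0<η k (ℚₚ.<⇒≤ (ℚₚ.≤-<-trans (p≤p+ε _ (ℚₚ.<⇒≤ 0<ε)) h))

dist< : ∀ {x y η} → ∣ x - y ∣ < fromℚ η →
  Eventually (λ n → ℚ.∣ seq x n ℚ.- seq y n ∣ ℚ.< η)
dist< (ε , 0<ε , near) =
  mapᵉ (ℚₚ.≤-<-trans (p≤p+ε _ (ℚₚ.<⇒≤ 0<ε))) near

-- The order on `ℝ` demands a fixed margin. Of the room `η + η` below `z`, one half holds the
-- distance and the other is the margin.
dist<⁻ : ∀ {x y z} η → 0ℚ ℚ.< η →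
  Eventually (λ n → ℚ.∣ seq x n ℚ.- seq y n ∣ ℚ.< η) →
  Eventually (λ n → η ℚ.+ η ℚ.≤ seq z n) → ∣ x - y ∣ < z
dist<⁻ η 0<η near gap = η , 0<η , mapᵉ
  (λ (h , k) → ℚₚ.<-≤-trans (ℚₚ.+-monoˡ-< η h) k) (near ∩ᵉ gap)

gap⇒0< : ∀ {x p} → 0ℚ ℚ.< p → Eventually (λ n → p ℚ.< seq x n) → 0ℝ < x
gap⇒0< {x} {p} 0<p gap = p , 0<p ,
  mapᵉ (λ {n} → subst (ℚ._< seq x n) (sym (ℚₚ.+-identityˡ p))) gap

0<⇒gap : ∀ {x} → 0ℝ < x → ∃[ p ] (0ℚ ℚ.< p × Eventually (λ n → p ℚ.< seq x n))
0<⇒gap {x} (p , 0<p , gap) = p , 0<p ,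
  mapᵉ (λ {n} → subst (ℚ._< seq x n) (ℚₚ.+-identityˡ p)) gap

0<fromℚ : ∀ {p} → 0ℚ ℚ.< p → 0ℝ < fromℚ p
0<fromℚ {p} 0<p with halve p 0<p
... | η , 0<η , refl = gap⇒0< {fromℚ p} 0<η (always λ _ →
  subst (ℚ._< η ℚ.+ η) (ℚₚ.+-identityʳ η) (ℚₚ.+-monoʳ-< η 0<η))

Near : ℚ → I → I → Set
Near δ s t = ∣ proj₁ t - proj₁ s ∣ < fromℚ δ

Near-mono : ∀ {δ δ′} s t → δ ℚ.≤ δ′ → Near δ s t → Near δ′ s t
Near-mono s t δ≤δ′ (ε , 0<ε , near) = ε , 0<ε , mapᵉ (λ h → ℚₚ.<-≤-trans h δ≤δ′) near

-- `Continuous` speaks of real tolerances; rational ones are easier to halve and to compare. A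
-- positive real eventually exceeds some positive rational, which replaces `δ`.
continuous-ℚ : ∀ {f} → Continuous f → ∀ s η → 0ℚ ℚ.< η →
  ∃[ δ ] (0ℚ ℚ.< δ × (∀ t → Near δ s t → ∣ f t - f s ∣ < fromℚ η))
continuous-ℚ f-cont s η 0<η with f-cont s (fromℚ η) (0<fromℚ 0<η)
... | δ , 0<δ , close with 0<⇒gap {δ} 0<δ
... | p , 0<p , p<δ = p , 0<p , λ t (ε , 0<ε , near) →
  close t (ε , 0<ε , mapᵉ (λ (h , k) → ℚₚ.<-trans h k) (near ∩ᵉ p<δ))

-- The margin is cut into four quarters `η`: each endpoint may use up one, and the remaining two are
-- the new margin.
<-open : ∀ {x y} → x < y → ∃[ η ] (0ℚ ℚ.< η ×
  (∀ x′ y′ → ∣ x′ - x ∣ < fromℚ η → ∣ y′ - y ∣ < fromℚ η → x′ < y′))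
<-open {x} {y} (ε , 0<ε , x<y) with halve ε 0<ε
... | ε₂ , 0<ε₂ , refl with halve ε₂ 0<ε₂
... | η , 0<η , refl = η , 0<η , λ x′ y′ x′-near y′-near → η ℚ.+ η , 0<ε₂ , mapᵉ
  (λ {n} (gap , hx , hy) → shift-<
    (ℚₚ.+-mono-< gap (ℚₚ.+-mono-<
      (near-upper (seq x′ n) (seq x n) hx) (near-lower (seq y′ n) (seq y n) hy)))
    (regroup (seq x n) (seq y n) (seq x′ n) (seq y′ n) η))
  (x<y ∩ᵉ dist< {x′} {x} x′-near ∩ᵉ dist< {y′} {y} y′-near)
  where
  regroup : ∀ x y x′ y′ η →
    (y ℚ.+ ((x ℚ.+ η) ℚ.+ (y′ ℚ.+ η))) ℚ.-
    ((x ℚ.+ ((η ℚ.+ η) ℚ.+ (η ℚ.+ η))) ℚ.+ (x′ ℚ.+ y)) ≡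
    y′ ℚ.- (x′ ℚ.+ (η ℚ.+ η))
  regroup = solve-∀ ℚ-ring

-- [0,1] is connected

0≤1 : 0ℚ ℚ.≤ 1ℚ
0≤1 = fromℕ-mono-≤ z≤n

-- Clamping spares the membership proofs when a rational is used as a point.
point : ℚ → I
point p = fromℚ (clamp 1ℚ p) ,
  seq-≤⇒≤ {0ℝ} {fromℚ (clamp 1ℚ p)} (always λ _ → 0≤clamp 1ℚ p) ,
  seq-≤⇒≤ {fromℚ (clamp 1ℚ p)} {1ℝ} (always λ _ → clamp≤ p 0≤1)

-- Termwise clamping places the limit in `[0,1]` with no assumption on `a`, and being non-expansive
-- it keeps the sequence Cauchy.
limit : (a : ℕ → ℚ) → IsCauchy a → I
limit a a-cauchy = x ,
  seq-≤⇒≤ {0ℝ} {x} (always λ n → 0≤clamp 1ℚ (a n)) ,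
  seq-≤⇒≤ {x} {1ℝ} (always λ n → clamp≤ (a n) 0≤1)
  where
  x : ℝ
  x = mkℝ (λ n → clamp 1ℚ (a n)) λ ε 0<ε →
    let N , near = a-cauchy ε 0<ε in
    N , λ m n N≤m N≤n →
      ℚₚ.≤-<-trans (clamp-nonExpansive 1ℚ (a m) (a n)) (near m n N≤m N≤n)

Near-intro : ∀ s t δ → 0ℚ ℚ.< δ →
  Eventually (λ n → ℚ.∣ seq (proj₁ t) n ℚ.- seq (proj₁ s) n ∣ ℚ.< δ) →
  Near (δ ℚ.+ δ) s t
Near-intro s t δ 0<δ near =
  dist<⁻ {proj₁ t} {proj₁ s} {fromℚ (δ ℚ.+ δ)} δ 0<δ near (always λ _ → ℚₚ.≤-refl)

Near-refl : ∀ s δ → 0ℚ ℚ.< δ → Near δ s s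
Near-refl s δ 0<δ with halve δ 0<δ
... | η , 0<η , refl = Near-intro s s η 0<η (always λ n →
  subst (ℚ._< η) (cong ℚ.∣_∣ (sym (ℚₚ.+-inverseʳ (seq (proj₁ s) n)))) 0<η)

-- The rational is a late term of `t`, clamped. That term lies in `[0,1]` only up to `η`, so
-- clamping costs `η`; the Cauchy tail costs another `η`, and `Near-intro` doubles the sum.
near-some-point′ : ∀ t η → 0ℚ ℚ.< η →
  ∃[ q ] (0ℚ ℚ.≤ q × Near ((η ℚ.+ η) ℚ.+ (η ℚ.+ η)) t (point q))
near-some-point′ t@(x , 0≤x , x≤1) η 0<η = q , 0≤clamp 1ℚ p ,
  Near-intro t (point q) (η ℚ.+ η) (ℚₚ.+-mono-< 0<η 0<η) (N , close)
  where
  N₁ = proj₁ (cauchy x η 0<η)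
  x-near = proj₂ (cauchy x η 0<η)
  bounds = ≤⇒seq-≤ {0ℝ} {x} 0≤x η 0<η ∩ᵉ ≤⇒seq-≤ {x} {1ℝ} x≤1 η 0<η
  N₂ = proj₁ bounds
  x-bound = proj₂ bounds
  N = N₁ ℕ.⊔ N₂
  p = seq x N
  q = clamp 1ℚ p
  0≤η = ℚₚ.<⇒≤ 0<η

  bound = x-bound N (ℕₚ.m≤n⊔m N₁ N₂)

  q-near-p : ℚ.∣ q ℚ.- p ∣ ℚ.≤ η
  q-near-p = ∣p-q∣≤ε q p
    (clamp≤+ 1ℚ p (shift-≤ (proj₁ bound) (swap p η)) 0≤η)
    (≤clamp+ 1ℚ p (proj₂ bound) 0≤η)
    where
    swap : ∀ p η → (p ℚ.+ η) ℚ.- 0ℚ ≡ p ℚ.- (ℚ.- η)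
    swap = solve-∀ ℚ-ring

  split : ∀ q p r → (q ℚ.- p) ℚ.+ (p ℚ.- r) ≡ q ℚ.- r
  split = solve-∀ ℚ-ring

  close : ∀ n → N ℕ.≤ n → ℚ.∣ clamp 1ℚ q ℚ.- seq x n ∣ ℚ.< η ℚ.+ η
  close n N≤n = begin-strict
    ℚ.∣ clamp 1ℚ q ℚ.- seq x n ∣
      ≡⟨ cong (λ r → ℚ.∣ r ℚ.- seq x n ∣) (clamp-id (0≤clamp 1ℚ p) (clamp≤ p 0≤1)) ⟩
    ℚ.∣ q ℚ.- seq x n ∣
      ≡⟨ cong ℚ.∣_∣ (split q p (seq x n)) ⟨
    ℚ.∣ (q ℚ.- p) ℚ.+ (p ℚ.- seq x n) ∣
      ≤⟨ ℚₚ.∣p+q∣≤∣p∣+∣q∣ (q ℚ.- p) (p ℚ.- seq x n) ⟩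
    ℚ.∣ q ℚ.- p ∣ ℚ.+ ℚ.∣ p ℚ.- seq x n ∣
      <⟨ ℚₚ.+-mono-≤-< q-near-p
           (x-near N n (ℕₚ.m≤m⊔n N₁ N₂) (ℕₚ.≤-trans (ℕₚ.m≤m⊔n N₁ N₂) N≤n)) ⟩
    η ℚ.+ η ∎
    where open ℚₚ.≤-Reasoning

near-some-point : ∀ t δ → 0ℚ ℚ.< δ → ∃[ q ] (0ℚ ℚ.≤ q × Near δ t (point q))
near-some-point t δ 0<δ with halve δ 0<δ
... | δ₂ , 0<δ₂ , refl with halve δ₂ 0<δ₂
... | η , 0<η , refl = near-some-point′ t η 0<η

halving : ℚ → ℕ → ℚ
halving q zero    = q
halving q (suc n) = ½ ℚ.* halving q n

halving-sum : ∀ q n → halving q (suc n) ℚ.+ halving q (suc n) ≡ halving q n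
halving-sum q n =
  trans (sym (ℚₚ.*-distribʳ-+ (halving q n) ½ ½)) (ℚₚ.*-identityˡ (halving q n))

0≤halving : ∀ {q} → 0ℚ ℚ.≤ q → ∀ n → 0ℚ ℚ.≤ halving q n
0≤halving 0≤q zero    = 0≤q
0≤halving 0≤q (suc n) = ℚₚ.*-monoˡ-≤-nonNeg ½ (0≤halving 0≤q n)

-- As `halving q n` is `q` divided by the `n`-th power of 2, this is the crude estimate that the
-- power is at least `n + 1`; convergence to 0 needs no more.
halving-bound : ∀ {q} → 0ℚ ℚ.≤ q → ∀ n → fromℕ (suc n) ℚ.* halving q n ℚ.≤ q
halving-bound {q} 0≤q zero = ℚₚ.≤-reflexive (ℚₚ.*-identityˡ q)
halving-bound {q} 0≤q (suc n) = begin
  fromℕ (2 ℕ.+ n) ℚ.* h                        ≡⟨ cong (ℚ._* h) (fromℕ-+ 1 (suc n)) ⟩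
  (1ℚ ℚ.+ fromℕ (suc n)) ℚ.* h                 ≤⟨ ℚₚ.*-monoʳ-≤-nonNeg h
                                                    (ℚₚ.+-monoˡ-≤ (fromℕ (suc n)) (fromℕ-mono-≤ {1} {suc n} (s≤s z≤n))) ⟩
  (fromℕ (suc n) ℚ.+ fromℕ (suc n)) ℚ.* h      ≡⟨ regroup (fromℕ (suc n)) h ⟩
  fromℕ (suc n) ℚ.* (h ℚ.+ h)                  ≡⟨ cong (fromℕ (suc n) ℚ.*_) (halving-sum q n) ⟩
  fromℕ (suc n) ℚ.* halving q n                ≤⟨ halving-bound 0≤q n ⟩
  q                                            ∎
  where
  open ℚₚ.≤-Reasoning
  h = halving q (suc n)
  instance _ = ℚ.nonNegative (0≤halving 0≤q (suc n))
  regroup : ∀ a h → (a ℚ.+ a) ℚ.* h ≡ a ℚ.* (h ℚ.+ h)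
  regroup = solve-∀ ℚ-ring

halving→0 : ∀ {q} → 0ℚ ℚ.≤ q → ∀ δ → 0ℚ ℚ.< δ → ∃[ N ] halving q N ℚ.< δ
halving→0 {q} 0≤q δ 0<δ = N , ℚₚ.*-cancelˡ-<-nonNeg (fromℕ (suc N)) (begin-strict
  fromℕ (suc N) ℚ.* halving q N     ≤⟨ halving-bound 0≤q N ⟩
  q                                 ≡⟨ ℚₚ.*-identityʳ q ⟨
  q ℚ.* 1ℚ                          ≡⟨ cong (q ℚ.*_) (ℚₚ.*-inverseˡ δ) ⟨
  q ℚ.* (ℚ.1/ δ ℚ.* δ)              ≡⟨ ℚₚ.*-assoc q (ℚ.1/ δ) δ ⟨
  q ℚ.* ℚ.1/ δ ℚ.* δ                <⟨ ℚₚ.*-monoˡ-<-pos δ (proj₂ (archimedean (q ℚ.* ℚ.1/ δ))) ⟩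
  fromℕ N ℚ.* δ                     ≤⟨ ℚₚ.*-monoʳ-≤-nonNeg δ (fromℕ-mono-≤ (ℕₚ.n≤1+n N)) ⟩
  fromℕ (suc N) ℚ.* δ               ∎)
  where
  open ℚₚ.≤-Reasoning
  instance
    δ-pos : ℚ.Positive δ
    δ-pos = ℚ.positive 0<δ
    δ-nonNeg : ℚ.NonNegative δ
    δ-nonNeg = ℚₚ.pos⇒nonNeg δ
    δ-nonZero : ℚ.NonZero δ
    δ-nonZero = ℚₚ.pos⇒nonZero δ
  -- Any `N` above `q / δ` works: then `q < N * δ`, and the factor `N + 1` cancels.
  N = proj₁ (archimedean (q ℚ.* ℚ.1/ δ))

-- The interval from `lo n` to `hi n` has width `halving q n`; `D` holds at its left end and fails
-- at its right end. Both ends converge to `crossing`, so `D` is both true and false arbitrarily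
-- close to that point.
module Bisection
  {D : ℚ → Set} (D? : ∀ p → Dec (D p))
  {q : ℚ} (0≤q : 0ℚ ℚ.≤ q) (D-0 : D 0ℚ) (¬D-q : ¬ D q)
  where

  step : ∀ {p} → ℚ → Dec (D p) → ℚ
  step {p} a (yes _) = p
  step     a (no _)  = a

  lo hi : ℕ → ℚ
  lo zero    = 0ℚ
  lo (suc n) = step (lo n) (D? (lo n ℚ.+ halving q (suc n)))
  hi n = lo n ℚ.+ halving q n

  private
    rejoin : ∀ a n →
      (a ℚ.+ halving q (suc n)) ℚ.+ halving q (suc n) ≡ a ℚ.+ halving q n
    rejoin a n = trans (ℚₚ.+-assoc a h h) (cong (a ℚ.+_) (halving-sum q n))
      where h = halving q (suc n)

  D-lo : ∀ n → D (lo n)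
  D-lo zero    = D-0
  D-lo (suc n) with D? (lo n ℚ.+ halving q (suc n))
  ... | yes d = d
  ... | no _  = D-lo n

  ¬D-hi : ∀ n → ¬ D (hi n)
  ¬D-hi zero    d = ¬D-q (subst D (ℚₚ.+-identityˡ q) d)
  ¬D-hi (suc n) d with D? (lo n ℚ.+ halving q (suc n))
  ... | yes _ = ¬D-hi n (subst D (rejoin (lo n) n) d)
  ... | no ¬d = ¬d d

  lo≤lo : ∀ n → lo n ℚ.≤ lo (suc n)
  lo≤lo n with D? (lo n ℚ.+ halving q (suc n))
  ... | yes _ = p≤p+ε (lo n) (0≤halving 0≤q (suc n))
  ... | no _  = ℚₚ.≤-refl

  hi≥hi : ∀ n → hi (suc n) ℚ.≤ hi n
  hi≥hi n with D? (lo n ℚ.+ halving q (suc n))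
  ... | yes _ = ℚₚ.≤-reflexive (rejoin (lo n) n)
  ... | no _  = ℚₚ.≤-trans (p≤p+ε _ (0≤halving 0≤q (suc n)))
                  (ℚₚ.≤-reflexive (rejoin (lo n) n))

  lo≤hi : ∀ n → lo n ℚ.≤ hi n
  lo≤hi n = p≤p+ε (lo n) (0≤halving 0≤q n)

  nested : ∀ {m n} → m ℕ.≤′ n → lo m ℚ.≤ lo n × hi n ℚ.≤ hi m
  nested (ℕ.≤′-reflexive refl) = ℚₚ.≤-refl , ℚₚ.≤-refl
  nested {n = suc n} (ℕ.≤′-step m≤n) =
    let lo≤ , hi≤ = nested m≤n in
    ℚₚ.≤-trans lo≤ (lo≤lo n) , ℚₚ.≤-trans (hi≥hi n) hi≤

  Inside : ℕ → ℚ → Set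
  Inside N p = lo N ℚ.≤ p × p ℚ.≤ hi N

  lo-inside : ∀ {N n} → N ℕ.≤ n → Inside N (lo n)
  lo-inside {n = n} N≤n =
    let lo≤ , hi≤ = nested (ℕₚ.≤⇒≤′ N≤n) in
    lo≤ , ℚₚ.≤-trans (lo≤hi n) hi≤

  hi-inside : ∀ N → Inside N (hi N)
  hi-inside N = lo≤hi N , ℚₚ.≤-refl

  inside-close : ∀ N p r → Inside N p → Inside N r →
    ℚ.∣ p ℚ.- r ∣ ℚ.≤ halving q N
  inside-close N p r (lo≤p , p≤hi) (lo≤r , r≤hi) = ∣p-q∣≤ε p r
    (ℚₚ.≤-trans p≤hi (ℚₚ.+-monoˡ-≤ (halving q N) lo≤r))
    (ℚₚ.≤-trans r≤hi (ℚₚ.+-monoˡ-≤ (halving q N) lo≤p))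

  lo-cauchy : IsCauchy lo
  lo-cauchy ε 0<ε =
    let N , small = halving→0 0≤q ε 0<ε in
    N , λ m n N≤m N≤n →
      ℚₚ.≤-<-trans (inside-close N (lo m) (lo n) (lo-inside N≤m) (lo-inside N≤n)) small

  crossing : I
  crossing = limit lo lo-cauchy

  inside-near : ∀ N p δ → 0ℚ ℚ.< δ → halving q N ℚ.< δ → Inside N p →
    Near (δ ℚ.+ δ) crossing (point p)
  inside-near N p δ 0<δ small inside =
    Near-intro crossing (point p) δ 0<δ (N , λ n N≤n →
      ℚₚ.≤-<-trans (clamp-nonExpansive 1ℚ p (lo n))
        (ℚₚ.≤-<-trans (inside-close N p (lo n) inside (lo-inside N≤n)) small))

  both-near : ∀ δ → 0ℚ ℚ.< δ → ∃[ N ]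
    (Near δ crossing (point (lo N)) × Near δ crossing (point (hi N)))
  both-near δ 0<δ with halve δ 0<δ
  ... | η , 0<η , refl =
    let N , small = halving→0 0≤q η 0<η in
    N , inside-near N (lo N) η 0<η small (lo-inside {N} ℕₚ.≤-refl) ,
        inside-near N (hi N) η 0<η small (hi-inside N)

-- A quantitative form of being clopen: every point has a ball inside `D` or inside its complement.
LocallyDecided : (I → Set) → Set
LocallyDecided D = ∀ s → ∃[ δ ] (0ℚ ℚ.< δ ×
  ((∀ t → Near δ s t → D t) ⊎ (∀ t → Near δ s t → ¬ D t)))

-- Connectedness of `[0,1]`. Were `D` to fail at a rational point, bisection from 0 would yield a
-- crossing near which neither verdict is possible. Density of the rational points then covers every
-- real `t`.
locallyDecided⇒constant : ExcludedMiddle 0ℓ → ∀ {D} → LocallyDecided D →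
  D (point 0ℚ) → ∀ t → D t
locallyDecided⇒constant em {D} decided D-0 t =
  let δ , 0<δ , verdict = decided t
      q , 0≤q , near    = near-some-point t δ 0<δ
  in case verdict of λ where
    (inj₁ near⇒D)  → near⇒D t (Near-refl t δ 0<δ)
    -- The ball around `t` contains the rational point `q`, where `D` is already known, so the
    -- negative verdict cannot occur.
    (inj₂ near⇒¬D) → contradiction (on-points q 0≤q) (near⇒¬D (point q) near)
  where
  on-points : ∀ q → 0ℚ ℚ.≤ q → D (point q)
  on-points q 0≤q = decidable-stable em λ ¬D-q →
    let open Bisection {λ p → D (point p)} (λ _ → em) 0≤q D-0 ¬D-q
        δ , 0<δ , verdict     = decided crossing
        N , lo-near , hi-near = both-near δ 0<δ
    in case verdict of λ where
      (inj₁ near⇒D)  → ¬D-hi N (near⇒D (point (hi N)) hi-near)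
      (inj₂ near⇒¬D) → near⇒¬D (point (lo N)) lo-near (D-lo N)

-- The intermediate value theorem. Strict inequality persists nearby in either direction, and
-- equality never occurs, so `f t < g t` is locally decided; connectedness carries it from 0 to all
-- of `[0,1]`.
below-everywhere : ExcludedMiddle 0ℓ → ∀ {f g} → Continuous f → Continuous g →
  (∀ t → ¬ f t ≈ g t) → f (point 0ℚ) < g (point 0ℚ) → ∀ t → f t < g t
below-everywhere em {f} {g} f-cont g-cont apart =
  locallyDecided⇒constant em {λ t → f t < g t} decided
  where
  stable : ∀ f g → Continuous f → Continuous g → ∀ s → f s < g s →
    ∃[ δ ] (0ℚ ℚ.< δ × (∀ t → Near δ s t → f t < g t))
  stable f g f-cont g-cont s fs<gs =
    let η , 0<η , open-η     = <-open {f s} {g s} fs<gs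
        δ₁ , 0<δ₁ , f-close = continuous-ℚ {f} f-cont s η 0<η
        δ₂ , 0<δ₂ , g-close = continuous-ℚ {g} g-cont s η 0<η
    in δ₁ ℚ.⊓ δ₂ , ⊓-pos 0<δ₁ 0<δ₂ , λ t near → open-η (f t) (g t)
      (f-close t (Near-mono s t (ℚₚ.p⊓q≤p δ₁ δ₂) near))
      (g-close t (Near-mono s t (ℚₚ.p⊓q≤q δ₁ δ₂) near))
    where
    ⊓-pos : ∀ {p q} → 0ℚ ℚ.< p → 0ℚ ℚ.< q → 0ℚ ℚ.< p ℚ.⊓ q
    ⊓-pos {p} {q} 0<p 0<q with ℚₚ.⊓-sel p q
    ... | inj₁ eq = subst (0ℚ ℚ.<_) (sym eq) 0<p
    ... | inj₂ eq = subst (0ℚ ℚ.<_) (sym eq) 0<q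

  decided : LocallyDecided (λ t → f t < g t)
  decided s with trichotomy em (f s) (g s)
  ... | inj₁ fs<gs =
    let δ , 0<δ , near = stable f g f-cont g-cont s fs<gs in δ , 0<δ , inj₁ near
  ... | inj₂ (inj₁ gs<fs) =
    let δ , 0<δ , near = stable g f g-cont f-cont s gs<fs
    in δ , 0<δ , inj₂ λ t t-near ft<gt → <-asym {f t} {g t} ft<gt (near t t-near)
  ... | inj₂ (inj₂ fs≈gs) = contradiction fs≈gs (apart s)

comparable : ExcludedMiddle 0ℓ → ∀ {f g} → Continuous f → Continuous g →
  (∀ t → ¬ f t ≈ g t) → (∀ t → f t < g t) ⊎ (∀ t → g t < f t)
comparable em {f} {g} f-cont g-cont apart
  with trichotomy em (f (point 0ℚ)) (g (point 0ℚ))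
... | inj₁ f<g        = inj₁ (below-everywhere em {f} {g} f-cont g-cont apart f<g)
... | inj₂ (inj₁ g<f) = inj₂ (below-everywhere em {g} {f} g-cont f-cont
  (λ t gt≈ft → apart t (≈-sym {g t} {f t} gt≈ft)) g<f)
... | inj₂ (inj₂ f≈g) = contradiction f≈g (apart (point 0ℚ))

-- Counting

module _ {A : Set} {P Q R : A → Set}
  (P? : Unary.Decidable P) (Q? : Unary.Decidable Q) (R? : Unary.Decidable R)
  where

  length-filter-∪ : (∀ {x} → P x → Q x ⊎ R x) → ∀ xs →
    length (filter P? xs) ℕ.≤ length (filter Q? xs) ℕ.+ length (filter R? xs)
  length-filter-∪ P⊆Q∪R [] = z≤n
  length-filter-∪ P⊆Q∪R (x ∷ xs)
    with ih ← length-filter-∪ P⊆Q∪R xs | P? x | Q? x | R? x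
  ... | no _  | no _  | no _  = ih
  ... | no _  | yes _ | no _  = ℕₚ.m≤n⇒m≤1+n ih
  ... | no _  | no _  | yes _ = ℕₚ.≤-trans ih (ℕₚ.+-monoʳ-≤ _ (ℕₚ.n≤1+n _))
  ... | no _  | yes _ | yes _ =
    ℕₚ.m≤n⇒m≤1+n (ℕₚ.≤-trans ih (ℕₚ.+-monoʳ-≤ _ (ℕₚ.n≤1+n _)))
  ... | yes _ | yes _ | no _  = s≤s ih
  ... | yes _ | yes _ | yes _ = s≤s (ℕₚ.≤-trans ih (ℕₚ.+-monoʳ-≤ _ (ℕₚ.n≤1+n _)))
  ... | yes _ | no _  | yes _ = ℕₚ.≤-trans (s≤s ih) (ℕₚ.≤-reflexive (sym (ℕₚ.+-suc _ _)))
  ... | yes p | no ¬q | no ¬r = contradiction (P⊆Q∪R p) [ ¬q , ¬r ]′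

module _ {A : Set} {P Q : A → Set} (P? : Unary.Decidable P) (Q? : Unary.Decidable Q)
  (P⊆Q : ∀ {x} → P x → Q x) where

  length-filter-⊆ : ∀ xs → length (filter P? xs) ℕ.≤ length (filter Q? xs)
  length-filter-⊆ [] = z≤n
  length-filter-⊆ (x ∷ xs) with ih ← length-filter-⊆ xs | P? x | Q? x
  ... | no _  | no _  = ih
  ... | no _  | yes _ = ℕₚ.m≤n⇒m≤1+n ih
  ... | yes _ | yes _ = s≤s ih
  ... | yes p | no ¬q = contradiction (P⊆Q p) ¬q

  length-filter-⊂ : ∀ {x xs} → x ∈ xs → ¬ P x → Q x →
    length (filter P? xs) ℕ.< length (filter Q? xs)
  length-filter-⊂ {x} {_ ∷ xs} (here refl) ¬p q with P? x | Q? x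
  ... | yes p | _     = contradiction p ¬p
  ... | no _  | no ¬q = contradiction q ¬q
  ... | no _  | yes _ = s≤s (length-filter-⊆ xs)
  length-filter-⊂ {xs = y ∷ _} (there x∈xs) ¬p q
    with ih ← length-filter-⊂ x∈xs ¬p q | P? y | Q? y
  ... | no _  | no _  = ih
  ... | no _  | yes _ = ℕₚ.m≤n⇒m≤1+n ih
  ... | yes _ | yes _ = s≤s ih
  ... | yes p | no ¬q = contradiction (P⊆Q p) ¬q

length≤1 : ∀ {A : Set} {xs : List A} → Unique xs →
  (∀ {x y} → x ∈ xs → y ∈ xs → x ≡ y) → length xs ℕ.≤ 1
length≤1 {xs = []}        _ _ = z≤n
length≤1 {xs = _ ∷ []}    _ _ = s≤s z≤n
length≤1 {xs = _ ∷ _ ∷ _} ((x≢y All.∷ _) ∷ _) all-equal =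
  contradiction (all-equal (here refl) (there (here refl))) x≢y

module _ {n : ℕ} {P : Fin n → Set} (P? : Unary.Decidable P) where

  count : ℕ
  count = length (filter P? (allFin n))

  count<n : ∀ {v} → ¬ P v → count ℕ.< n
  count<n {v} ¬p = subst (count ℕ.<_) (length-tabulate _)
    (filter-notAll P? (allFin n) (lose (∈-allFin v) ¬p))

  count≡0 : (∀ v → ¬ P v) → count ≡ 0
  count≡0 ¬p = cong length (filter-none P? (All.universal ¬p (allFin n)))

  count≤1 : (∀ {u v} → P u → P v → u ≡ v) → count ℕ.≤ 1
  count≤1 P-unique = length≤1 (Uniqueₚ.filter⁺ P? (Uniqueₚ.allFin⁺ n)) λ u∈ v∈ →
    P-unique (proj₂ (∈-filter⁻ P? {xs = allFin n} u∈))
             (proj₂ (∈-filter⁻ P? {xs = allFin n} v∈))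

-- Degrees and widths

degree≤maxDegree : ∀ {n} (G : Graph n) v → degree G v ℕ.≤ maxDegree G
degree≤maxDegree G v = v≤max⁺ 0 _
  (inj₂ (lose (∈-map⁺ (degree G) (∈-allFin v)) ℕₚ.≤-refl))

maxDegree≤ : ∀ {n} (G : Graph n) {d} → (∀ v → degree G v ℕ.≤ d) → maxDegree G ℕ.≤ d
maxDegree≤ {n} G deg≤d = max≤v⁺ z≤n (Allₚ.map⁺ (All.universal deg≤d (allFin n)))

distance : ∀ {n} → Permutation′ n → Fin n → Fin n → ℕ
distance σ u v = ℕ.∣ toℕ (σ ⟨$⟩ʳ u) - toℕ (σ ⟨$⟩ʳ v) ∣

distance≤width : ∀ {n} (G : Graph n) σ u v → T (adj G u v) → distance σ u v ℕ.≤ width G σ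
distance≤width G σ u v uv = v≤max⁺ 0 _ (inj₂ (lose
  (∈-map⁺ _ (∈-filter⁺ _ (∈-cartesianProduct⁺ (∈-allFin u) (∈-allFin v)) uv)) ℕₚ.≤-refl))

width≤ : ∀ {n} (G : Graph n) σ {d} → (∀ u v → T (adj G u v) → distance σ u v ℕ.≤ d) →
  width G σ ℕ.≤ d
width≤ {n} G σ dist≤d = max≤v⁺ z≤n (Allₚ.map⁺
  (All.map (λ {(u , v)} → dist≤d u v)
    (Allₚ.all-filter (λ e → T? (uncurry (adj G) e)) (cartesianProduct (allFin n) (allFin n)))))

-- Linear extensions

-- Surjectivity is the pigeonhole principle: a missed value could be adjoined to `f`, giving an
-- injection from `Fin (suc n)` into `Fin n`.
injective⇒permutation : ∀ {n} (f : Fin n → Fin n) → Injective _≡_ _≡_ f →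
  ∃[ σ ] (∀ i → σ ⟨$⟩ʳ i ≡ f i)
injective⇒permutation {n} f f-inj = permutation f (proj₁ ∘ preimage)
  (proj₂ ∘ preimage) (λ i → f-inj (proj₂ (preimage (f i)))) , λ _ → refl
  where
  preimage : ∀ j → ∃[ i ] f i ≡ j
  preimage j = decidable-stable (Finₚ.any? λ i → f i Fin.≟ j) λ missed →
    ℕₚ.1+n≰n (Finₚ.injective⇒≤ (extend-injective missed))
    where
    extend : Fin (suc n) → Fin n
    extend Fin.zero    = j
    extend (Fin.suc i) = f i
    extend-injective : ¬ (∃[ i ] f i ≡ j) → Injective _≡_ _≡_ extend
    extend-injective missed {Fin.zero}  {Fin.zero}  _  = refl
    extend-injective missed {Fin.zero}  {Fin.suc i} eq = contradiction (i , sym eq) missed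
    extend-injective missed {Fin.suc i} {Fin.zero}  eq = contradiction (i , eq) missed
    extend-injective missed {Fin.suc i} {Fin.suc k} eq = cong Fin.suc (f-inj eq)

-- An element is ranked by its number of predecessors. If `u ≺ v`, transitivity makes every
-- predecessor of `u` one of `v`, and `u` itself is an additional one. Incomparable elements may
-- share a rank.
module Rank {n : ℕ} {_≺_ : Rel (Fin n) 0ℓ} (_≺?_ : Decidable _≺_)
  (≺-irrefl : ∀ v → ¬ v ≺ v) (≺-trans : Transitive _≺_) where

  below : Fin n → ℕ
  below v = count (_≺? v)

  rank : Fin n → Fin n
  rank v = fromℕ< (count<n (_≺? v) (≺-irrefl v))

  toℕ-rank : ∀ v → toℕ (rank v) ≡ below v
  toℕ-rank v = Finₚ.toℕ-fromℕ< (count<n (_≺? v) (≺-irrefl v))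

  below-mono : ∀ {u v} → u ≺ v → below u ℕ.< below v
  below-mono {u} {v} u≺v = length-filter-⊂ (_≺? u) (_≺? v)
    (λ w≺u → ≺-trans w≺u u≺v) (∈-allFin u) (≺-irrefl u) u≺v

  rank-mono : ∀ {u v} → u ≺ v → rank u Fin.< rank v
  rank-mono {u} {v} u≺v rewrite toℕ-rank u | toℕ-rank v = below-mono u≺v

module LinearExtension {n : ℕ} {_≺_ : Rel (Fin n) 0ℓ} (_≺?_ : Decidable _≺_)
  (≺-irrefl : ∀ v → ¬ v ≺ v) (≺-trans : Transitive _≺_) where

  open Rank _≺?_ ≺-irrefl ≺-trans using (rank; rank-mono)

  -- The lexicographic pair of rank and vertex number, coded as one number: ties between equal ranks
  -- are broken by the vertex itself.
  key : Fin n → Fin (n ℕ.* n)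
  key v = combine (rank v) v

  infix 4 _⊏_ _⊏?_
  _⊏_ : Rel (Fin n) 0ℓ
  u ⊏ v = key u Fin.< key v

  _⊏?_ : Decidable _⊏_
  u ⊏? v = key u Fin.<? key v

  ≺⇒⊏ : ∀ {u v} → u ≺ v → u ⊏ v
  ≺⇒⊏ {u} {v} u≺v = Finₚ.combine-monoˡ-< u v (rank-mono u≺v)

  ⊏-connex : ∀ {u v} → u ≢ v → u ⊏ v ⊎ v ⊏ u
  ⊏-connex {u} {v} u≢v with Finₚ.<-cmp (key u) (key v)
  ... | tri< u⊏v _ _ = inj₁ u⊏v
  ... | tri≈ _ eq _  = contradiction (Finₚ.combine-injectiveʳ (rank u) u (rank v) v eq) u≢v
  ... | tri> _ _ v⊏u = inj₂ v⊏u

  -- Ranking a second time, now along the total order `_⊏_`, compresses the keys to distinct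
  -- positions in `Fin n`. A position is a number of predecessors, which the edge estimate can
  -- count.
  open Rank _⊏?_ (λ _ → ℕₚ.<-irrefl refl) (λ {u} {v} {w} → ℕₚ.<-trans) public
    using ()
    renaming (rank to position; rank-mono to position-mono;
              below to before; toℕ-rank to toℕ-position)

  position-injective : Injective _≡_ _≡_ position
  position-injective {u} {v} eq = decidable-stable (u Fin.≟ v) λ u≢v →
    [ (λ u⊏v → Finₚ.<⇒≢ (position-mono u⊏v) eq)
    , (λ v⊏u → Finₚ.<⇒≢ (position-mono v⊏u) (sym eq)) ]′ (⊏-connex u≢v)

-- Bandwidth of a co-comparability graph

∣-∣-≤ : ∀ {m n d} → m ℕ.≤ n → n ℕ.≤ m ℕ.+ d → ℕ.∣ m - n ∣ ℕ.≤ d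
∣-∣-≤ {m} {n} {d} m≤n n≤m+d =
  subst (ℕ._≤ d) (sym (ℕₚ.m≤n⇒∣m-n∣≡n∸m m≤n)) (ℕₚ.m≤n+o⇒m∸n≤o n m n≤m+d)

-- The last two hypotheses make `H` the incomparability graph of the strict order `_≺_`.
module _ {n : ℕ} (H : Graph n) {_≺_ : Rel (Fin n) 0ℓ} (_≺?_ : Decidable _≺_)
  (≺-irrefl : ∀ v → ¬ v ≺ v) (≺-trans : Transitive _≺_)
  (adjacent⇒⊀ : ∀ u v → T (adj H u v) → ¬ u ≺ v)
  (nonadjacent⇒comparable : ∀ u v → u ≢ v → ¬ T (adj H u v) → u ≺ v ⊎ v ≺ u)
  where

  open LinearExtension _≺?_ ≺-irrefl ≺-trans

  private
    Δ = maxDegree H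

    -- A vertex between the endpoints of an edge that is adjacent to neither
    -- would make the endpoints comparable.
    between : ∀ {u v w} → T (adj H u v) → w ⊏ v →
      w ⊏ u ⊎ (T (adj H u w) ⊎ T (adj H v w))
    between {u} {v} {w} uv w⊏v
      with w ⊏? u | T? (adj H u w) | T? (adj H v w) | w Fin.≟ u
    ... | yes w⊏u | _      | _      | _        = inj₁ w⊏u
    ... | no _    | yes uw | _      | _        = inj₂ (inj₁ uw)
    ... | no _    | no _   | yes vw | _        = inj₂ (inj₂ vw)
    -- The vertex `u` does not precede itself, but it is counted among the neighbours of `v`.
    ... | no _    | no _   | no ¬vw | yes refl = contradiction (symm H u v uv) ¬vw
    ... | no w⊏̸u | no ¬uw | no ¬vw | no w≢u
      with nonadjacent⇒comparable u w (w≢u ∘ sym) ¬uw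
         | nonadjacent⇒comparable v w (λ { refl → ℕₚ.<-irrefl refl w⊏v }) ¬vw
    ...   | inj₂ w≺u | _        = contradiction (≺⇒⊏ w≺u) w⊏̸u
    ...   | _        | inj₁ v≺w = contradiction (≺⇒⊏ v≺w) (ℕₚ.<-asym w⊏v)
    ...   | inj₁ u≺w | inj₂ w≺v = contradiction (≺-trans u≺w w≺v) (adjacent⇒⊀ u v uv)

    -- By `between`, the predecessors of `v` are covered by those of `u` and the two neighbourhoods,
    -- each of size at most `Δ`.
    before≤ : ∀ {u v} → T (adj H u v) → before v ℕ.≤ before u ℕ.+ 2 ℕ.* Δ
    before≤ {u} {v} uv = begin
      before v
        ≤⟨ length-filter-∪ (_⊏? v) (_⊏? u) (λ w → T? (adj H u w) ⊎-dec T? (adj H v w))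
             (between uv) (allFin n) ⟩
      before u ℕ.+ count (λ w → T? (adj H u w) ⊎-dec T? (adj H v w))
        ≤⟨ ℕₚ.+-monoʳ-≤ (before u) (length-filter-∪ _ (T? ∘ adj H u) (T? ∘ adj H v)
             (λ p → p) (allFin n)) ⟩
      before u ℕ.+ (degree H u ℕ.+ degree H v)
        ≤⟨ ℕₚ.+-monoʳ-≤ (before u) (ℕₚ.+-mono-≤ (degree≤maxDegree H u) (degree≤maxDegree H v)) ⟩
      before u ℕ.+ (Δ ℕ.+ Δ)
        ≡⟨ cong (λ d → before u ℕ.+ (Δ ℕ.+ d)) (ℕₚ.+-identityʳ Δ) ⟨
      before u ℕ.+ 2 ℕ.* Δ ∎
      where
      open ℕₚ.≤-Reasoning

    position≤ : ∀ {u v} → u ⊏ v → T (adj H u v) →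
      ℕ.∣ toℕ (position u) - toℕ (position v) ∣ ℕ.≤ 2 ℕ.* Δ
    position≤ {u} {v} u⊏v uv = ∣-∣-≤ (ℕₚ.<⇒≤ (position-mono u⊏v)) bound
      where
      bound : toℕ (position v) ℕ.≤ toℕ (position u) ℕ.+ 2 ℕ.* Δ
      bound rewrite toℕ-position u | toℕ-position v = before≤ uv

  ∃-width≤2Δ : ∀ {G} → G ⊆ H → ∃[ σ ] width G σ ℕ.≤ 2 ℕ.* Δ
  ∃-width≤2Δ {G} G⊆H = σ , width≤ G σ λ u v uv →
    bound u v (G⊆H u v uv) (⊏-connex λ { refl → irrefl G u uv })
    where
    σ = proj₁ (injective⇒permutation position position-injective)

    bound : ∀ u v → T (adj H u v) → u ⊏ v ⊎ v ⊏ u → distance σ u v ℕ.≤ 2 ℕ.* Δ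
    bound u v uv (inj₁ u⊏v) = position≤ u⊏v uv
    bound u v uv (inj₂ v⊏u) = subst (ℕ._≤ 2 ℕ.* Δ)
      (ℕₚ.∣-∣-comm (toℕ (position v)) (toℕ (position u))) (position≤ v⊏u (symm H u v uv))

-- Powers of a path

Close : ∀ {n} → Permutation′ n → ℕ → Fin n → Fin n → Set
Close σ k u v = u ≢ v × distance σ u v ℕ.≤ k

close? : ∀ {n} (σ : Permutation′ n) k → Decidable (Close σ k)
close? σ k u v = ¬? (u Fin.≟ v) ×-dec (distance σ u v ℕ.≤? k)

pathPower : ∀ {n} → Permutation′ n → ℕ → Graph n
pathPower σ k = record
  { adj    = λ u v → ⌊ close? σ k u v ⌋
  ; symm   = λ u v uv →
      let u≢v , near = toWitness {a? = close? σ k u v} uv in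
      fromWitness (u≢v ∘ sym , subst (ℕ._≤ k)
        (ℕₚ.∣-∣-comm (toℕ (σ ⟨$⟩ʳ u)) (toℕ (σ ⟨$⟩ʳ v))) near)
  ; irrefl = λ v vv → proj₁ (toWitness {a? = close? σ k v v} vv) refl
  }

⊆-pathPower : ∀ {n} (G : Graph n) σ → G ⊆ pathPower σ (width G σ)
⊆-pathPower G σ u v uv = fromWitness
  ((λ { refl → irrefl G u uv }) , distance≤width G σ u v uv)

module _ {n} (σ : Permutation′ n) where

  label : Fin n → ℕ
  label v = toℕ (σ ⟨$⟩ʳ v)

  label-injective : Injective _≡_ _≡_ label
  label-injective = Injection.injective (↔⇒↣ σ) ∘ Finₚ.toℕ-injective

  ∣-∣≡⇒ : ∀ {a b d} → ℕ.∣ a - b ∣ ≡ d → b ≡ a ℕ.+ d ⊎ a ≡ b ℕ.+ d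
  ∣-∣≡⇒ {a} {b} refl with ℕₚ.≤-total a b
  ... | inj₁ a≤b = inj₁ (sym (trans (cong (a ℕ.+_) (ℕₚ.m≤n⇒∣m-n∣≡n∸m a≤b)) (ℕₚ.m+[n∸m]≡n a≤b)))
  ... | inj₂ b≤a = inj₂ (sym (trans (cong (b ℕ.+_) (ℕₚ.m≤n⇒∣n-m∣≡n∸m b≤a)) (ℕₚ.m+[n∸m]≡n b≤a)))

  -- Raising `k` by one admits at most two more vertices, those whose labels lie exactly `suc k`
  -- above or below the label of `v`.
  count-close≤ : ∀ k v → count (close? σ k v) ℕ.≤ 2 ℕ.* k
  count-close≤ zero v = ℕₚ.≤-reflexive (count≡0 (close? σ 0 v) λ w (v≢w , d≤0) →
    v≢w (label-injective (ℕₚ.∣m-n∣≡0⇒m≡n (ℕₚ.n≤0⇒n≡0 d≤0))))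
  count-close≤ (suc k) v = begin
    count (close? σ (suc k) v)
      ≤⟨ length-filter-∪ (close? σ (suc k) v) (close? σ k v)
           (λ w → above? w ⊎-dec below? w) split (allFin n) ⟩
    count (close? σ k v) ℕ.+ count (λ w → above? w ⊎-dec below? w)
      ≤⟨ ℕₚ.+-mono-≤ (count-close≤ k v)
           (length-filter-∪ _ above? below? (λ p → p) (allFin n)) ⟩
    2 ℕ.* k ℕ.+ (count above? ℕ.+ count below?)
      ≤⟨ ℕₚ.+-monoʳ-≤ (2 ℕ.* k) (ℕₚ.+-mono-≤ above≤1 below≤1) ⟩
    2 ℕ.* k ℕ.+ 2
      ≡⟨ ℕₚ.+-comm (2 ℕ.* k) 2 ⟩
    2 ℕ.+ 2 ℕ.* k
      ≡⟨ ℕₚ.*-suc 2 k ⟨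
    2 ℕ.* suc k ∎
    where
    open ℕₚ.≤-Reasoning
    above? : Unary.Decidable (λ w → label w ≡ label v ℕ.+ suc k)
    above? w = label w ℕ.≟ label v ℕ.+ suc k
    -- Written as a sum to avoid truncated subtraction; cancellation then gives uniqueness.
    below? : Unary.Decidable (λ w → label v ≡ label w ℕ.+ suc k)
    below? w = label v ℕ.≟ label w ℕ.+ suc k

    split : ∀ {w} → Close σ (suc k) v w → Close σ k v w ⊎
      (label w ≡ label v ℕ.+ suc k ⊎ label v ≡ label w ℕ.+ suc k)
    split (v≢w , d≤1+k) with ℕₚ.m≤n⇒m<n∨m≡n d≤1+k
    ... | inj₁ (s≤s d≤k) = inj₁ (v≢w , d≤k)
    ... | inj₂ d≡1+k     = inj₂ (∣-∣≡⇒ d≡1+k)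

    above≤1 : count above? ℕ.≤ 1
    above≤1 = count≤1 above? λ u≡ w≡ → label-injective (trans u≡ (sym w≡))
    below≤1 : count below? ℕ.≤ 1
    below≤1 = count≤1 below? λ u≡ w≡ →
      label-injective (ℕₚ.+-cancelʳ-≡ (suc k) _ _ (trans (sym u≡) w≡))

maxDegree-pathPower≤ : ∀ {n} (σ : Permutation′ n) k → maxDegree (pathPower σ k) ℕ.≤ 2 ℕ.* k
maxDegree-pathPower≤ {n} σ k = maxDegree≤ (pathPower σ k) λ v → ℕₚ.≤-trans
  (length-filter-⊆ (λ u → T? ⌊ close? σ k v u ⌋) (close? σ k v)
    toWitness (allFin n))
  (count-close≤ σ k v)

-- Path powers are function graphs

UniformlyContinuous : (ℚ → ℚ) → Set
UniformlyContinuous φ = ∀ ε → 0ℚ ℚ.< ε → ∃[ δ ] (0ℚ ℚ.< δ ×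
  (∀ p q → ℚ.∣ p ℚ.- q ∣ ℚ.< δ → ℚ.∣ φ p ℚ.- φ q ∣ ℚ.< ε))

module _ (φ : ℚ → ℚ) (φ-uniform : UniformlyContinuous φ) where

  -- The function acts termwise on the representing sequence. Uniform continuity keeps it Cauchy
  -- even when the limit is irrational, and the same modulus gives continuity at every real point.
  extend : I → ℝ
  extend (x , _) = mkℝ (λ n → φ (seq x n)) λ ε 0<ε →
    let δ , 0<δ , φ-close = φ-uniform ε 0<ε
        N , near          = cauchy x δ 0<δ
    in N , λ m n N≤m N≤n → φ-close (seq x m) (seq x n) (near m n N≤m N≤n)

  extend-continuous : Continuous extend
  extend-continuous s ε 0<ε =
    let p , 0<p , p<ε         = 0<⇒gap {ε} 0<ε
        η , 0<η , η+η≡p       = halve p 0<p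
        δ , 0<δ , φ-close     = φ-uniform η 0<η
    in fromℚ δ , 0<fromℚ 0<δ , λ t near →
      dist<⁻ {extend t} {extend s} {ε} η 0<η
        (mapᵉ (λ {n} → φ-close (seq (proj₁ t) n) (seq (proj₁ s) n))
          (dist< {proj₁ t} {proj₁ s} near))
        (mapᵉ (λ {n} p<εₙ → subst (ℚ._≤ seq ε n) (sym η+η≡p) (ℚₚ.<⇒≤ p<εₙ)) p<ε)

module Ramps (n k : ℕ) where

  -- In the time `speed * q`, ramp `i` rises from `k * i` to `k * i + k`, so the ramps with labels
  -- below `n` are done by `k * n`. The successor keeps `speed` invertible.
  speed : ℕ
  speed = suc (k ℕ.* n)

  -- The ramps rise one after the other, in the order of their labels, each
  -- from i to i + k; so ramp i sweeps over exactly those labels in i,…,i + k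
  -- whose ramps still wait at their initial height.
  ramp : ℕ → ℚ → ℚ
  ramp i q = fromℕ i ℚ.+ clamp (fromℕ k) (fromℕ speed ℚ.* q ℚ.- fromℕ (k ℕ.* i))

  ramp-lipschitz : ∀ i p q →
    ℚ.∣ ramp i p ℚ.- ramp i q ∣ ℚ.≤ fromℕ speed ℚ.* ℚ.∣ p ℚ.- q ∣
  ramp-lipschitz i p q = begin
    ℚ.∣ ramp i p ℚ.- ramp i q ∣
      ≡⟨ cong ℚ.∣_∣ (cancelˡ (fromℕ i) (clamp (fromℕ k) x) (clamp (fromℕ k) y)) ⟩
    ℚ.∣ clamp (fromℕ k) x ℚ.- clamp (fromℕ k) y ∣
      ≤⟨ clamp-nonExpansive (fromℕ k) x y ⟩
    ℚ.∣ x ℚ.- y ∣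
      ≡⟨ cong ℚ.∣_∣ (factor (fromℕ speed) p q (fromℕ (k ℕ.* i))) ⟩
    ℚ.∣ fromℕ speed ℚ.* (p ℚ.- q) ∣
      ≡⟨ ℚₚ.∣p*q∣≡∣p∣*∣q∣ (fromℕ speed) (p ℚ.- q) ⟩
    fromℕ speed ℚ.* ℚ.∣ p ℚ.- q ∣ ∎
    where
    open ℚₚ.≤-Reasoning
    x = fromℕ speed ℚ.* p ℚ.- fromℕ (k ℕ.* i)
    y = fromℕ speed ℚ.* q ℚ.- fromℕ (k ℕ.* i)
    cancelˡ : ∀ a x y → (a ℚ.+ x) ℚ.- (a ℚ.+ y) ≡ x ℚ.- y
    cancelˡ = solve-∀ ℚ-ring
    factor : ∀ m p q c → (m ℚ.* p ℚ.- c) ℚ.- (m ℚ.* q ℚ.- c) ≡ m ℚ.* (p ℚ.- q)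
    factor = solve-∀ ℚ-ring

  rescale : ℚ → ℚ
  rescale p = ℚ.1/ fromℕ speed ℚ.* p

  speed*rescale : ∀ p → fromℕ speed ℚ.* rescale p ≡ p
  speed*rescale p = trans (sym (ℚₚ.*-assoc (fromℕ speed) (ℚ.1/ fromℕ speed) p))
    (trans (cong (ℚ._* p) (ℚₚ.*-inverseʳ (fromℕ speed))) (ℚₚ.*-identityˡ p))

  ramp-uniform : ∀ i → UniformlyContinuous (ramp i)
  ramp-uniform i ε 0<ε = rescale ε , 0<rescale , λ p q near →
    ℚₚ.≤-<-trans (ramp-lipschitz i p q)
      (subst (fromℕ speed ℚ.* ℚ.∣ p ℚ.- q ∣ ℚ.<_) (speed*rescale ε)
        (ℚₚ.*-monoʳ-<-pos (fromℕ speed) near))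
    where
    0<rescale : 0ℚ ℚ.< rescale ε
    0<rescale = subst (ℚ._< rescale ε) (ℚₚ.*-zeroʳ (ℚ.1/ fromℕ speed))
      (ℚₚ.*-monoʳ-<-pos (ℚ.1/ fromℕ speed) 0<ε)

  path : ℕ → I → ℝ
  path i = extend (ramp i) (ramp-uniform i)

  -- Ramp `i` never exceeds `i + k` and ramp `j` never drops below `j`. These integers differ by at
  -- least 1, which leaves room for the margin `½`.
  far⇒< : ∀ {i j} → i ℕ.+ k ℕ.< j → ∀ t → path i t < path j t
  far⇒< {i} {j} i+k<j (x , _) = ½ , 0<½ , always λ m → begin-strict
    ramp i (seq x m) ℚ.+ ½
      ≤⟨ ℚₚ.+-monoˡ-≤ ½ (ℚₚ.+-monoʳ-≤ (fromℕ i) (clamp≤ (rise i m) (fromℕ-mono-≤ {0} {k} z≤n))) ⟩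
    (fromℕ i ℚ.+ fromℕ k) ℚ.+ ½
      ≡⟨ cong (ℚ._+ ½) (fromℕ-+ i k) ⟨
    fromℕ (i ℕ.+ k) ℚ.+ ½
      <⟨ ℚₚ.+-monoʳ-< (fromℕ (i ℕ.+ k)) ½<1 ⟩
    fromℕ (i ℕ.+ k) ℚ.+ fromℕ 1
      ≡⟨ fromℕ-+ (i ℕ.+ k) 1 ⟨
    fromℕ (i ℕ.+ k ℕ.+ 1)
      ≤⟨ fromℕ-mono-≤ (ℕₚ.≤-trans (ℕₚ.≤-reflexive (ℕₚ.+-comm (i ℕ.+ k) 1)) i+k<j) ⟩
    fromℕ j
      ≤⟨ p≤p+ε (fromℕ j) (0≤clamp (fromℕ k) (rise j m)) ⟩
    ramp j (seq x m) ∎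
    where
    open ℚₚ.≤-Reasoning
    rise : ℕ → ℕ → ℚ
    rise l m = fromℕ speed ℚ.* seq x m ℚ.- fromℕ (k ℕ.* l)
    0<½ : 0ℚ ℚ.< ½
    0<½ = ℚₚ.positive⁻¹ ½
    ½<1 : ½ ℚ.< fromℕ 1
    ½<1 = ℚ.*<* (ℤ.+<+ (s≤s (s≤s z≤n)))

  -- At `time`, ramp `i` has been rising for `suc d` units and has reached height `j`, while ramp
  -- `j` still waits there, since it starts only at `k * j`. The bound `i < n` puts this moment
  -- inside `[0,1]`.
  module Crossing (i d : ℕ) (i<n : i ℕ.< n) (1+d≤k : suc d ℕ.≤ k) where

    j = i ℕ.+ suc d
    time = k ℕ.* i ℕ.+ suc d
    q = rescale (fromℕ time)

    time≤speed : time ℕ.≤ speed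
    time≤speed = begin
      k ℕ.* i ℕ.+ suc d  ≤⟨ ℕₚ.+-monoʳ-≤ (k ℕ.* i) 1+d≤k ⟩
      k ℕ.* i ℕ.+ k      ≡⟨ ℕₚ.+-comm (k ℕ.* i) k ⟩
      k ℕ.+ k ℕ.* i      ≡⟨ ℕₚ.*-suc k i ⟨
      k ℕ.* suc i        ≤⟨ ℕₚ.*-monoʳ-≤ k i<n ⟩
      k ℕ.* n            ≤⟨ ℕₚ.n≤1+n _ ⟩
      speed              ∎
      where open ℕₚ.≤-Reasoning

    clamp-q : clamp 1ℚ q ≡ q
    clamp-q = clamp-id
      (subst (ℚ._≤ q) (ℚₚ.*-zeroʳ s⁻¹) (ℚₚ.*-monoˡ-≤-nonNeg s⁻¹ (fromℕ-mono-≤ {0} {time} z≤n)))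
      (subst (q ℚ.≤_) (ℚₚ.*-inverseˡ (fromℕ speed))
        (ℚₚ.*-monoˡ-≤-nonNeg s⁻¹ (fromℕ-mono-≤ time≤speed)))
      where s⁻¹ = ℚ.1/ fromℕ speed

    argument : ∀ l → fromℕ speed ℚ.* clamp 1ℚ q ℚ.- fromℕ (k ℕ.* l) ≡
      fromℕ time ℚ.- fromℕ (k ℕ.* l)
    argument l = cong (ℚ._- fromℕ (k ℕ.* l))
      (trans (cong (fromℕ speed ℚ.*_) clamp-q) (speed*rescale (fromℕ time)))

    lower : ramp i (clamp 1ℚ q) ≡ fromℕ j
    lower = begin
      fromℕ i ℚ.+ clamp (fromℕ k) (fromℕ speed ℚ.* clamp 1ℚ q ℚ.- fromℕ (k ℕ.* i))
        ≡⟨ cong (λ r → fromℕ i ℚ.+ clamp (fromℕ k) r) (trans (argument i) risen) ⟩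
      fromℕ i ℚ.+ clamp (fromℕ k) (fromℕ (suc d))
        ≡⟨ cong (fromℕ i ℚ.+_) (clamp-id (fromℕ-mono-≤ {0} {suc d} z≤n) (fromℕ-mono-≤ 1+d≤k)) ⟩
      fromℕ i ℚ.+ fromℕ (suc d)
        ≡⟨ fromℕ-+ i (suc d) ⟨
      fromℕ j ∎
      where
      open ≡-Reasoning
      cancel : ∀ a b → (a ℚ.+ b) ℚ.- a ≡ b
      cancel = solve-∀ ℚ-ring
      risen : fromℕ time ℚ.- fromℕ (k ℕ.* i) ≡ fromℕ (suc d)
      risen = trans (cong (ℚ._- fromℕ (k ℕ.* i)) (fromℕ-+ (k ℕ.* i) (suc d)))
        (cancel (fromℕ (k ℕ.* i)) (fromℕ (suc d)))

    upper : ramp j (clamp 1ℚ q) ≡ fromℕ j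
    upper = begin
      fromℕ j ℚ.+ clamp (fromℕ k) (fromℕ speed ℚ.* clamp 1ℚ q ℚ.- fromℕ (k ℕ.* j))
        ≡⟨ cong (λ r → fromℕ j ℚ.+ clamp (fromℕ k) r) (argument j) ⟩
      fromℕ j ℚ.+ clamp (fromℕ k) (fromℕ time ℚ.- fromℕ (k ℕ.* j))
        ≡⟨ cong (fromℕ j ℚ.+_) (clamp-zero {fromℕ k} waiting) ⟩
      fromℕ j ℚ.+ 0ℚ
        ≡⟨ ℚₚ.+-identityʳ (fromℕ j) ⟩
      fromℕ j ∎
      where
      open ≡-Reasoning
      time≤k*j : time ℕ.≤ k ℕ.* j
      time≤k*j = ℕₚ.≤-trans
        (ℕₚ.+-monoʳ-≤ (k ℕ.* i)
          -- Since `suc d ≤ k`, the factor `k` is nonzero.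
          (ℕₚ.m≤n*m (suc d) k {{ℕ.>-nonZero (ℕₚ.≤-trans (s≤s z≤n) 1+d≤k)}}))
        (ℕₚ.≤-reflexive (sym (ℕₚ.*-distribˡ-+ k i (suc d))))
      drop : ∀ a b → b ℚ.- a ≡ 0ℚ ℚ.- (a ℚ.- b)
      drop = solve-∀ ℚ-ring
      waiting : fromℕ time ℚ.- fromℕ (k ℕ.* j) ℚ.≤ 0ℚ
      waiting = shift-≤ (fromℕ-mono-≤ time≤k*j) (drop (fromℕ time) (fromℕ (k ℕ.* j)))

    meet : path i (point q) ≈ path j (point q)
    meet ε 0<ε = always λ _ → subst (ℚ._< ε)
      (cong ℚ.∣_∣ (sym (trans (cong₂ ℚ._-_ lower upper) (ℚₚ.+-inverseʳ (fromℕ j))))) 0<ε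

  near⇒meet : ∀ {i j} → i ℕ.< n → i ℕ.< j → j ℕ.≤ i ℕ.+ k → ∃[ t ] path i t ≈ path j t
  near⇒meet {i} {j} i<n i<j j≤i+k = point (Crossing.q i d i<n 1+d≤k) ,
    subst (λ j → path i (point (Crossing.q i d i<n 1+d≤k)) ≈
                 path j (point (Crossing.q i d i<n 1+d≤k)))
      i+1+d≡j (Crossing.meet i d i<n 1+d≤k)
    where
    d = j ℕ.∸ suc i
    i+1+d≡j : i ℕ.+ suc d ≡ j
    i+1+d≡j = trans (ℕₚ.+-suc i d) (ℕₚ.m+[n∸m]≡n i<j)
    1+d≤k : suc d ℕ.≤ k
    1+d≤k = ℕₚ.+-cancelˡ-≤ i (suc d) k (ℕₚ.≤-trans (ℕₚ.≤-reflexive i+1+d≡j) j≤i+k)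

pathPower-isFunctionGraph : ∀ {n} (σ : Permutation′ n) k → IsFunctionGraph (pathPower σ k)
pathPower-isFunctionGraph {n} σ k =
  (λ v → path (label σ v)) ,
  (λ v → extend-continuous (ramp (label σ v)) (ramp-uniform (label σ v))) ,
  λ u v u≢v → mk⇔
    (λ uv → crossing u≢v (proj₂ (toWitness {a? = close? σ k u v} uv)))
    (λ (t , meet) → fromWitness (u≢v , ℕₚ.≮⇒≥ λ far → apart t far meet))
  where
  open Ramps n k

  label<n : ∀ v → label σ v ℕ.< n
  label<n v = Finₚ.toℕ<n (σ ⟨$⟩ʳ v)

  crossing : ∀ {u v} → u ≢ v → distance σ u v ℕ.≤ k →
    ∃[ t ] path (label σ u) t ≈ path (label σ v) t
  crossing {u} {v} u≢v near with ℕₚ.<-cmp (label σ u) (label σ v)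
  ... | tri≈ _ eq _  = contradiction (label-injective σ eq) u≢v
  ... | tri< u<v _ _ = near⇒meet (label<n u) u<v
    (ℕₚ.≤-trans (ℕₚ.m≤n+∣n-m∣ (label σ v) (label σ u)) (ℕₚ.+-monoʳ-≤ (label σ u) near))
  ... | tri> _ _ v<u =
    let t , meet = near⇒meet (label<n v) v<u (ℕₚ.≤-trans
          (ℕₚ.m≤n+∣m-n∣ (label σ u) (label σ v)) (ℕₚ.+-monoʳ-≤ (label σ v) near))
    in t , ≈-sym {path (label σ v) t} {path (label σ u) t} meet

  m+k<n : ∀ {m n} → m ℕ.≤ n → k ℕ.< ℕ.∣ m - n ∣ → m ℕ.+ k ℕ.< n
  m+k<n {m} {n} m≤n far = subst (m ℕ.+ k ℕ.<_) (ℕₚ.m+[n∸m]≡n m≤n)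
    (ℕₚ.+-monoʳ-< m (subst (k ℕ.<_) (ℕₚ.m≤n⇒∣m-n∣≡n∸m m≤n) far))

  apart : ∀ {u v} t → k ℕ.< distance σ u v → ¬ path (label σ u) t ≈ path (label σ v) t
  apart {u} {v} t far meet with ℕₚ.≤-total (label σ u) (label σ v)
  ... | inj₁ u≤v = <⇒≉ {path (label σ u) t} {path (label σ v) t}
    (far⇒< (m+k<n u≤v far) t) meet
  ... | inj₂ v≤u = <⇒≉ {path (label σ v) t} {path (label σ u) t}
    (far⇒< (m+k<n v≤u (subst (k ℕ.<_) (ℕₚ.∣-∣-comm (label σ u) (label σ v)) far)) t)
    (≈-sym {path (label σ u) t} {path (label σ v) t} meet)

-- Comparing the two minima

functionGraph-width : ExcludedMiddle 0ℓ → ∀ {n} {G H : Graph n} →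
  IsFunctionGraph H → G ⊆ H → ∃[ σ ] width G σ ℕ.≤ 2 ℕ.* maxDegree H
functionGraph-width em {n} {G} {H} (f , f-cont , adj⇔meet) G⊆H =
  ∃-width≤2Δ H {_≺_} (λ _ _ → em) ≺-irrefl ≺-trans adjacent⇒⊀ nonadjacent⇒comparable {G} G⊆H
  where
  _≺_ : Fin n → Fin n → Set
  u ≺ v = ∀ t → f u t < f v t

  ≺-irrefl : ∀ v → ¬ v ≺ v
  ≺-irrefl v v≺v = <-asym {f v t} {f v t} (v≺v t) (v≺v t)
    -- An order imposed at every point is irreflexive because `[0,1]` is inhabited.
    where t = point 0ℚ

  ≺-trans : ∀ {u v w} → u ≺ v → v ≺ w → u ≺ w
  ≺-trans {u} {v} {w} u≺v v≺w t = <-trans {f u t} {f v t} {f w t} (u≺v t) (v≺w t)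

  adjacent⇒⊀ : ∀ u v → T (adj H u v) → ¬ u ≺ v
  adjacent⇒⊀ u v uv u≺v =
    let t , meet = Equivalence.to (adj⇔meet u v λ { refl → irrefl H u uv }) uv
    in <⇒≉ {f u t} {f v t} (u≺v t) meet

  nonadjacent⇒comparable : ∀ u v → u ≢ v → ¬ T (adj H u v) → u ≺ v ⊎ v ≺ u
  nonadjacent⇒comparable u v u≢v ¬uv = comparable em {f u} {f v} (f-cont u) (f-cont v)
    λ t meet → ¬uv (Equivalence.from (adj⇔meet u v u≢v) (t , meet))

-- Descent through attained values: excluded middle decides whether a smaller one exists, and the
-- bound `k` on the current value drops at each step.
minimum : ExcludedMiddle 0ℓ → {A : Set} (f : A → ℕ) → A → ∃[ m ] IsMinimumOf f m
minimum em {A} f a = go (f a) a ℕₚ.≤-refl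
  where
  go : ∀ k a → f a ℕ.≤ k → ∃[ m ] IsMinimumOf f m
  go zero    a fa≤0   = f a , (a , refl) , λ _ → ℕₚ.≤-trans fa≤0 z≤n
  go (suc k) a fa≤1+k with em {∃[ b ] f b ℕ.< f a}
  ... | yes (b , fb<fa) = go k b (ℕₚ.≤-pred (ℕₚ.≤-trans fb<fa fa≤1+k))
  ... | no none         = f a , (a , refl) , λ b → ℕₚ.≮⇒≥ λ fb<fa → none (b , fb<fa)

-- The operation `_/_` normalises, so the comparison is moved to unnormalised fractions, where it is
-- cross-multiplication.
half≤ : ∀ m n → m ℕ.≤ 2 ℕ.* n → + m / 2 ℚ.≤ + n / 1
half≤ m n m≤2n = ℚₚ.toℚᵘ-cancel-≤
  (ℚᵘₚ.≤-respˡ-≃ (ℚᵘₚ.≃-sym (ℚₚ.toℚᵘ-fromℚᵘ (ℚᵘ.mkℚᵘ (+ m) 1)))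
  (ℚᵘₚ.≤-respʳ-≃ (ℚᵘₚ.≃-sym (ℚₚ.toℚᵘ-fromℚᵘ (ℚᵘ.mkℚᵘ (+ n) 0)))
  (ℚᵘ.*≤* (begin
    + m ℤ.* + 1    ≡⟨ ℤₚ.*-identityʳ (+ m) ⟩
    + m            ≤⟨ ℤ.+≤+ m≤2n ⟩
    + (2 ℕ.* n)    ≡⟨ cong +_ (ℕₚ.*-comm 2 n) ⟩
    + (n ℕ.* 2)    ≡⟨ ℤₚ.pos-* n 2 ⟩
    + n ℤ.* + 2    ∎))))
  where open ℤₚ.≤-Reasoning

pathPower-supergraph : ∀ {n} (G : Graph n) → Permutation′ n → FunctionSupergraph G
pathPower-supergraph G σ = pathPower σ (width G σ) ,
  pathPower-isFunctionGraph σ (width G σ) , ⊆-pathPower G σ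

bandwidth≤2B_f : ExcludedMiddle 0ℓ → ∀ {n} (G : Graph n) {b b_f} →
  IsBandwidth G b → IsB_f G b_f → b ℕ.≤ 2 ℕ.* b_f
bandwidth≤2B_f em G (_ , b≤) (((H , H-function , G⊆H) , refl) , _) =
  let τ , width≤2Δ = functionGraph-width em {G = G} {H} H-function G⊆H
  in ℕₚ.≤-trans (b≤ τ) width≤2Δ

B_f≤2bandwidth : ∀ {n} (G : Graph n) {b b_f} →
  IsBandwidth G b → IsB_f G b_f → b_f ℕ.≤ 2 ℕ.* b
B_f≤2bandwidth G ((σ , refl) , _) (_ , b_f≤) = ℕₚ.≤-trans
  (b_f≤ (pathPower-supergraph G σ)) (maxDegree-pathPower≤ σ (width G σ))

mainTheorem7 : ExcludedMiddle 0ℓ →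
    (n : ℕ) (G : Graph n) →
    ∃[ b ] ∃[ b_f ]
    (IsBandwidth G b × IsB_f G b_f ×
    (+ b / 2) ℚ.≤ (+ b_f / 1) ×
    b_f ℕ.≤ 2 ℕ.* b)
mainTheorem7 em n G = assemble
  -- The identity labelling starts the first descent; its path power starts the second and shows
  -- that `G` has a function supergraph at all.
  (minimum em (width G) Permutation.id)
  (minimum em (λ (G′ , _) → maxDegree G′) (pathPower-supergraph G Permutation.id))
  where
  assemble : ∃[ b ] IsBandwidth G b → ∃[ d ] IsB_f G d →
    ∃[ b ] ∃[ b_f ] (IsBandwidth G b × IsB_f G b_f ×
      (+ b / 2) ℚ.≤ (+ b_f / 1) × b_f ℕ.≤ 2 ℕ.* b)
  assemble (b , b-min) (b_f , b_f-min) = b , b_f , b-min , b_f-min ,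
    half≤ b b_f (bandwidth≤2B_f em G b-min b_f-min) , B_f≤2bandwidth G b-min b_f-min
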